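{- The class of $(\overline{2P_1+P_2},\,2P_1+P_3)$-free graphs has bounded clique-width.
   Context: All graphs are finite, simple and undirected. For graphs $H_1,\dots,H_p$, a graph $G$ is $(H_1,\dots,H_p)$-free if no induced subgraph of $G$ is isomorphic to any $H_i$. $P_r$ denotes the path on $r$ vertices; $G+H$ is the disjoint union of $G$ and $H$, and $rG$ is the disjoint union of $r$ copies of $G$; $\overline{G}$ is the complement of $G$. Thus $\overline{2P_1+P_2}$ is the diamond ($K_4$ minus an edge). The clique-width of a graph $G$ is the minimum number of labels needed to construct $G$ using the operations: (1) create a single vertex with label $i$; (2) take the disjoint union of two labelled graphs; (3) add all edges between vertices with label $i$ and vertices with label $j$ ($i\ne j$); (4) rename label $i$ to $j$. A class of graphs has bounded clique-width if there is a constant $c$ such that every graph in the class has clique-width at most $c$. -}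

module Defs where

open import Data.Nat using (ℕ; zero; suc; _+_; _≤_)
open import Data.Fin using (Fin; zero; suc; toℕ; splitAt; _≟_)
open import Data.Bool using (Bool; true; false; _∨_; _∧_)
open import Data.Bool.Properties using (∨-comm)
open import Data.Sum using (_⊎_; inj₁; inj₂)
open import Data.Product using (Σ; _×_; ∃; ∃-syntax; _,_)
open import Relation.Nullary using (¬_)
open import Relation.Nullary.Decidable using (⌊_⌋)
open import Relation.Binary.PropositionalEquality using (_≡_; _≢_; refl)
open import Function.Bundles using (_↔_; Inverse)
open import Function.Definitions using (Injective)

record Graph : Set where
  field
    n       : ℕ
    adj     : Fin n → Fin n → Bool
    adj-sym : ∀ u v → adj u v ≡ adj v u
    irrefl  : ∀ u → adj u u ≡ false
open Graph public

InducedSub : Graph → Graph → Set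
InducedSub H G =
  Σ (Fin (n H) → Fin (n G)) λ f →
    Injective _≡_ _≡_ f × (∀ u v → adj G (f u) (f v) ≡ adj H u v)

Free : Graph → Graph → Set
Free H G = ¬ InducedSub H G

private
  symAdj : (ℕ → ℕ → Bool) → ∀ {k} → Fin k → Fin k → Bool
  symAdj e u v = e (toℕ u) (toℕ v) ∨ e (toℕ v) (toℕ u)

  symAdj-sym : (e : ℕ → ℕ → Bool) → ∀ {k} (u v : Fin k) →
               symAdj e u v ≡ symAdj e v u
  symAdj-sym e u v = ∨-comm (e (toℕ u) (toℕ v)) (e (toℕ v) (toℕ u))

e-2P₁+P₃ : ℕ → ℕ → Bool
e-2P₁+P₃ 2 3 = true
e-2P₁+P₃ 3 4 = true
e-2P₁+P₃ _ _ = false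

2P₁+P₃ : Graph
2P₁+P₃ = record
  { n = 5 ; adj = symAdj e-2P₁+P₃ ; adj-sym = symAdj-sym e-2P₁+P₃
  ; irrefl = λ { zero → refl ; (suc zero) → refl ; (suc (suc zero)) → refl
               ; (suc (suc (suc zero))) → refl ; (suc (suc (suc (suc zero)))) → refl } }

-- the diamond = complement of 2P₁ + P₂ (2P₁+P₂: vertices 0,1 isolated, edge 2-3);
-- so the diamond has all edges on {0,1,2,3} except 2-3
e-diamond : ℕ → ℕ → Bool
e-diamond 0 1 = true
e-diamond 0 2 = true
e-diamond 0 3 = true
e-diamond 1 2 = true
e-diamond 1 3 = true
e-diamond _ _ = false

diamond : Graph
diamond = record
  { n = 4 ; adj = symAdj e-diamond ; adj-sym = symAdj-sym e-diamond
  ; irrefl = λ { zero → refl ; (suc zero) → refl ; (suc (suc zero)) → refl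
               ; (suc (suc (suc zero))) → refl } }

data Expr (k : ℕ) : Set where
  vertex  : Fin k → Expr k
  union   : Expr k → Expr k → Expr k
  join    : (i j : Fin k) → i ≢ j → Expr k → Expr k
  relabel : (i j : Fin k) → Expr k → Expr k

size : ∀ {k} → Expr k → ℕ
size (vertex i)      = 1
size (union a b)     = size a + size b
size (join i j _ e)  = size e
size (relabel i j e) = size e

label : ∀ {k} (e : Expr k) → Fin (size e) → Fin k
label (vertex i) _ = i
label (union a b) x with splitAt (size a) x
... | inj₁ y = label a y
... | inj₂ y = label b y
label (join i j _ e) x = label e x
label (relabel i j e) x with label e x ≟ i
... | Relation.Nullary.yes _ = j
... | Relation.Nullary.no _  = label e x

edge : ∀ {k} (e : Expr k) → Fin (size e) → Fin (size e) → Bool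
edge (vertex i) _ _ = false
edge (union a b) x y with splitAt (size a) x | splitAt (size a) y
... | inj₁ x' | inj₁ y' = edge a x' y'
... | inj₂ x' | inj₂ y' = edge b x' y'
... | _       | _       = false
edge (join i j _ e) x y =
  edge e x y ∨ ((⌊ label e x ≟ i ⌋ ∧ ⌊ label e y ≟ j ⌋) ∨
                (⌊ label e x ≟ j ⌋ ∧ ⌊ label e y ≟ i ⌋))
edge (relabel i j e) x y = edge e x y

Realises : ∀ {k} → Expr k → Graph → Set
Realises e G =
  Σ (Fin (size e) ↔ Fin (n G)) λ bij →
    ∀ x y → adj G (Inverse.to bij x) (Inverse.to bij y) ≡ edge e x y

-- clique-width of G is at most c (the null graph has clique-width 0)
CWAtMost : ℕ → Graph → Set
CWAtMost c G = (n G ≡ 0) ⊎ (∃[ k ] (k ≤ c × ∃[ e ] Realises {k} e G))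

BoundedCW : (Graph → Set) → Set
BoundedCW P = ∃[ c ] (∀ G → P G → CWAtMost c G)

{-# OPTIONS --safe #-}

-- A graph has bounded clique-width as soon as its vertices can be ordered so that every
-- prefix has boundedly many distinct neighbourhoods in the rest. Such an order exists when,
-- after removing boundedly many vertices, the graph is P₃-free (a disjoint union of cliques),
-- or its vertices fall into three classes such that complementing inside and between classes
-- leaves a graph of maximum degree 2.
--
-- A (diamond, 2P₁+P₃)-free graph is always of one of these two types. By Ramsey's theorem it is
-- small, or has an independent set of size 5, or a clique of size 5.
--
-- Independent set I: a vertex has at most one neighbour in I or misses at most one vertex of I.
-- The vertices of the first kind induce a P₃-free graph, those of the second kind (B) are
-- independent. If B is small, remove it. Otherwise B can play the role of I, and the vertices
-- split into B, an independent set co-matched to B, and a clique with no edges to the rest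
-- (two exceptional vertices removed).
--
-- Clique: let K be the maximal clique containing it. Unless few vertices remain or Ramsey's theorem
-- yields an independent set as above, there is a second maximal clique L outside K. Every vertex outside a maximal clique has at most one neighbour in it, so vertices
-- missing a given small set are easy to find in K and L, and hence the remainder M is P₃-free.
-- If M is a clique then K, L and M are joined by matchings, up to three vertices. If M has
-- two nonadjacent vertices x and y, all edges between M and L end in a single vertex; with that
-- vertex and the neighbours in K of x, y and some z in L removed, the graph is P₃-free.

module Submission where

open import Defs
open import Data.Bool using (Bool; true; false; not; _∨_; _∧_) renaming (_≟_ to _≟ᵇ_)
open import Data.Bool.Properties using (⇔→≡; ¬-not)
open import Data.Empty using (⊥; ⊥-elim)
open import Data.Fin using (Fin; zero; suc; splitAt; combine; _≟_; _↑ˡ_; _↑ʳ_)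
  renaming (join to joinFin; _<_ to _<ᶠ_)
open import Data.Fin.Properties using
  (any?; splitAt-↑ˡ; splitAt-↑ʳ; join-splitAt; combine-injective; combine-injectiveˡ;
   combine-injectiveʳ; ↑ˡ-injective; ↑ʳ-injective; injective⇒≤; <-cmp)
open import Data.List using (List; []; _∷_; length; lookup; map; filter; foldr; allFin)
open import Data.List.Membership.Propositional using (_∈_; _∉_; find)
open import Data.List.Membership.Propositional.Properties using
  (∈-map⁺; ∈-map⁻; ∈-filter⁺; ∈-filter⁻; ∈-lookup; ∈-allFin)
open import Data.List.Properties using (length-tabulate)
open import Data.List.Relation.Unary.All as All using (All; []; _∷_)
open import Data.List.Relation.Unary.AllPairs as AllPairs using (AllPairs; []; _∷_)
open import Data.List.Relation.Unary.Any as Any using (here; there; index)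
open import Data.List.Relation.Unary.Any.Properties using (lookup-result)
open import Data.List.Relation.Unary.Unique.Propositional using (Unique)
open import Data.List.Relation.Unary.Unique.Propositional.Properties using (allFin⁺; filter⁺)
open import Data.Nat using (ℕ; zero; suc; _+_; _*_; _≤_; _<_; z≤n; s≤s; _≤?_)
open import Data.Nat.Properties using
  (≤-trans; ≤-reflexive; ≤-refl; ≤-pred; n≮n; ≰⇒>; <⇒≤; <⇒≱; +-suc; m≤n+m; m≤m+n;
   *-monoʳ-≤; +-mono-≤; +-monoˡ-≤)
open import Data.Product using (Σ; ∃; ∃₂; _×_; _,_; proj₁; proj₂)
open import Data.Sum using (_⊎_; inj₁; inj₂; [_,_]′)
open import Data.Unit using (⊤; tt)
open import Function using (_∘_; const; id; _⇔_; mk⇔; mk↔ₛ′; Equivalence)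
open import Relation.Binary.Definitions using (tri<; tri≈; tri>)
open import Relation.Binary.PropositionalEquality using
  (_≡_; _≢_; refl; sym; trans; cong; subst)
open import Relation.Binary.PropositionalEquality.Properties using (setoid)
open import Relation.Nullary using (¬_; Dec; yes; no; contradiction)
open import Relation.Nullary.Decidable using (⌊_⌋; ¬?; _×-dec_; _⊎-dec_; does)
open import Relation.Unary using (Decidable)
import Data.List.Membership.DecPropositional as DecMembership
import Data.List.Membership.Setoid.Properties as SetoidMembership

-- Expressions over a list of named vertices

module _ {N : ℕ} {A : Set} where

  _↦_else_ : Fin N → A → (Fin N → A) → Fin N → A
  (v ↦ a else f) u with u ≟ v
  ... | yes _ = a
  ... | no _  = f u

  ↦-same : ∀ v {a f} → (v ↦ a else f) v ≡ a
  ↦-same v with v ≟ v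
  ... | yes _  = refl
  ... | no v≢v = contradiction refl v≢v

  ↦-other : ∀ v a f {u} → u ≢ v → (v ↦ a else f) u ≡ f u
  ↦-other v _ _ {u} u≢v with u ≟ v
  ... | yes u≡v = contradiction u≡v u≢v
  ... | no _    = refl

module _ {K : ℕ} where

  move : Fin K → Fin K → Fin K → Fin K
  move i j c with c ≟ i
  ... | yes _ = j
  ... | no _  = c

  move-≡ : ∀ i j → move i j i ≡ j
  move-≡ i j with i ≟ i
  ... | yes _  = refl
  ... | no i≢i = contradiction refl i≢i

  move-≢ : ∀ {i j c} → c ≢ i → move i j c ≡ c
  move-≢ {i} {c = c} c≢i with c ≟ i
  ... | yes c≡i = contradiction c≡i c≢i
  ... | no _    = refl

-- Labels and edges are prescribed on named vertices instead of positions of `expr`, so that they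
-- survive changes of the expression. Only their values on `U` matter, which `resp` exploits.
record Built {N K : ℕ} (U : List (Fin N)) (lab : Fin N → Fin K)
             (ed : Fin N → Fin N → Bool) : Set where
  field
    expr     : Expr K
    pos      : Fin (size expr) → Fin N
    pos-inj  : ∀ {x y} → pos x ≡ pos y → x ≡ y
    pos-∈    : ∀ x → pos x ∈ U
    pos-onto : ∀ {u} → u ∈ U → ∃ λ x → pos x ≡ u
    label-≡  : ∀ x → label expr x ≡ lab (pos x)
    edge-≡   : ∀ x y → edge expr x y ≡ ed (pos x) (pos y)

module _ {N K : ℕ} where

  private
    V = Fin N
    variable
      U : List V
      lab lab′ : V → Fin K
      ed ed′ : V → V → Bool

  single : ∀ v → Built {K = K} (v ∷ []) lab (λ _ _ → false)
  single {lab = lab} v = record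
    { expr = vertex (lab v)
    ; pos = λ _ → v
    ; pos-inj = λ { {zero} {zero} _ → refl }
    ; pos-∈ = λ _ → here refl
    ; pos-onto = λ { (here refl) → zero , refl }
    ; label-≡ = λ _ → refl
    ; edge-≡ = λ _ _ → refl }

  resp : (∀ {u} → u ∈ U → lab u ≡ lab′ u) →
         (∀ {u w} → u ∈ U → w ∈ U → ed u w ≡ ed′ u w) →
         Built U lab ed → Built U lab′ ed′
  resp l≡ e≡ b = record
    { Built b hiding (label-≡; edge-≡)
    ; label-≡ = λ x → trans (label-≡ x) (l≡ (pos-∈ x))
    ; edge-≡ = λ x y → trans (edge-≡ x y) (e≡ (pos-∈ x) (pos-∈ y)) }
    where open Built b

  add : ∀ {v} → v ∉ U → (∀ w → ed v w ≡ false) → (∀ w → ed w v ≡ false) →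
        Built U lab ed → Built (v ∷ U) lab ed
  add {U = U} {ed = ed} {lab = lab} {v = v} v∉U ev≡ e≡v b = record
    { expr = expr′
    ; pos = pos′
    ; pos-inj = λ {x} {y} → inj x y
    ; pos-∈ = ∈′
    ; pos-onto = onto
    ; label-≡ = label′
    ; edge-≡ = edge′ }
    where
    open Built b
    expr′ = union expr (vertex (lab v))

    side : Fin (size expr) ⊎ Fin 1 → V
    side = [ pos , const v ]′

    pos′ : Fin (size expr′) → V
    pos′ x = side (splitAt (size expr) x)

    side-inj : ∀ s t → side s ≡ side t → s ≡ t
    side-inj (inj₁ x) (inj₁ y) eq = cong inj₁ (pos-inj eq)
    side-inj (inj₁ x) (inj₂ _) eq = contradiction (subst (_∈ U) eq (pos-∈ x)) v∉U
    side-inj (inj₂ _) (inj₁ y) eq = contradiction (subst (_∈ U) (sym eq) (pos-∈ y)) v∉U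
    side-inj (inj₂ zero) (inj₂ zero) eq = refl

    inj : ∀ x y → pos′ x ≡ pos′ y → x ≡ y
    inj x y eq = trans (sym (join-splitAt (size expr) 1 x))
      (trans (cong (joinFin (size expr) 1) (side-inj (splitAt (size expr) x) (splitAt (size expr) y) eq))
             (join-splitAt (size expr) 1 y))

    ∈′ : ∀ x → pos′ x ∈ v ∷ U
    ∈′ x with splitAt (size expr) x
    ... | inj₁ y = there (pos-∈ y)
    ... | inj₂ _ = here refl

    onto : ∀ {u} → u ∈ v ∷ U → ∃ λ x → pos′ x ≡ u
    onto (here refl) = size expr ↑ʳ zero , cong side (splitAt-↑ʳ (size expr) 1 zero)
    onto (there u∈U) with pos-onto u∈U
    ... | x , refl = x ↑ˡ 1 , cong side (splitAt-↑ˡ (size expr) x 1)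

    label′ : ∀ x → label expr′ x ≡ lab (pos′ x)
    label′ x with splitAt (size expr) x
    ... | inj₁ y = label-≡ y
    ... | inj₂ _ = refl

    edge′ : ∀ x y → edge expr′ x y ≡ ed (pos′ x) (pos′ y)
    edge′ x y with splitAt (size expr) x | splitAt (size expr) y
    ... | inj₁ x′ | inj₁ y′ = edge-≡ x′ y′
    ... | inj₁ x′ | inj₂ _  = sym (e≡v _)
    ... | inj₂ _  | inj₁ y′ = sym (ev≡ _)
    ... | inj₂ _  | inj₂ _  = sym (ev≡ v)

  joinEdge : (i j : Fin K) → (V → Fin K) → (V → V → Bool) → V → V → Bool
  joinEdge i j lab ed u w = ed u w ∨
    ((⌊ lab u ≟ i ⌋ ∧ ⌊ lab w ≟ j ⌋) ∨ (⌊ lab u ≟ j ⌋ ∧ ⌊ lab w ≟ i ⌋))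

  joinB : ∀ {i j} → i ≢ j → Built U lab ed → Built U lab (joinEdge i j lab ed)
  joinB {i = i} {j} i≢j b = record
    { Built b hiding (expr; edge-≡)
    ; expr = join i j i≢j expr
    ; edge-≡ = λ x y → helper (edge-≡ x y) (label-≡ x) (label-≡ y) }
    where
    open Built b
    helper : ∀ {p q : Bool} {a a′ c c′} → p ≡ q → a ≡ a′ → c ≡ c′ →
      p ∨ ((⌊ a ≟ i ⌋ ∧ ⌊ c ≟ j ⌋) ∨ (⌊ a ≟ j ⌋ ∧ ⌊ c ≟ i ⌋)) ≡
      q ∨ ((⌊ a′ ≟ i ⌋ ∧ ⌊ c′ ≟ j ⌋) ∨ (⌊ a′ ≟ j ⌋ ∧ ⌊ c′ ≟ i ⌋))
    helper refl refl refl = refl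

  private
    ⌊⌋⁻ : ∀ {A : Set} (d : Dec A) → ⌊ d ⌋ ≡ true → A
    ⌊⌋⁻ (yes a) _ = a

    ⌊⌋⁺ : ∀ {A : Set} (d : Dec A) → A → ⌊ d ⌋ ≡ true
    ⌊⌋⁺ (yes _) _ = refl
    ⌊⌋⁺ (no ¬a) a = contradiction a ¬a

    ∨⁻ : ∀ p {q} → p ∨ q ≡ true → p ≡ true ⊎ q ≡ true
    ∨⁻ true  _  = inj₁ refl
    ∨⁻ false eq = inj₂ eq

    ∨⁺ʳ : ∀ p {q} → q ≡ true → p ∨ q ≡ true
    ∨⁺ʳ true  _  = refl
    ∨⁺ʳ false eq = eq

    both⁻ : ∀ {A B : Set} (c : Dec A) (d : Dec B) → ⌊ c ⌋ ∧ ⌊ d ⌋ ≡ true → A × B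
    both⁻ (yes a) d eq = a , ⌊⌋⁻ d eq

    both⁺ : ∀ {A B : Set} (c : Dec A) (d : Dec B) → A → B → ⌊ c ⌋ ∧ ⌊ d ⌋ ≡ true
    both⁺ c d a b rewrite ⌊⌋⁺ c a = ⌊⌋⁺ d b

  Linked : List (Fin K) → Fin K → (V → Fin K) → V → V → Set
  Linked ls j lab u w = (lab u ∈ ls × lab w ≡ j) ⊎ (lab u ≡ j × lab w ∈ ls)

  -- `ls` may repeat labels, and a repeated join adds nothing. An equivalence describes the result
  -- without regard to order or repetition.
  joinAll : ∀ ls {j} → j ∉ ls → Built U lab ed →
    Σ (V → V → Bool) λ ed′ → Built U lab ed′ ×
      (∀ u w → ed′ u w ≡ true ⇔ (ed u w ≡ true ⊎ Linked ls j lab u w))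
  joinAll {ed = ed} [] j∉ b = ed , b , λ u w → mk⇔ inj₁
    λ { (inj₁ eq) → eq ; (inj₂ (inj₁ (() , _))) ; (inj₂ (inj₂ (_ , ()))) }
  joinAll {lab = lab} {ed = ed} (i ∷ ls) {j} j∉ b with joinAll ls (j∉ ∘ there) b
  ... | ed′ , b′ , iff = joinEdge i j lab ed′ , joinB (λ eq → j∉ (here (sym eq))) b′ ,
      λ u w → mk⇔ (to u w) (from u w)
    where
    to : ∀ u w → joinEdge i j lab ed′ u w ≡ true →
         ed u w ≡ true ⊎ Linked (i ∷ ls) j lab u w
    to u w eq with ∨⁻ (ed′ u w) eq
    ... | inj₂ eq₂ with ∨⁻ (⌊ lab u ≟ i ⌋ ∧ _) eq₂
    ...   | inj₁ eq₃ = let a , c = both⁻ (lab u ≟ i) (lab w ≟ j) eq₃ in inj₂ (inj₁ (here a , c))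
    ...   | inj₂ eq₃ = let a , c = both⁻ (lab u ≟ j) (lab w ≟ i) eq₃ in inj₂ (inj₂ (a , here c))
    to u w eq | inj₁ eq₁ with Equivalence.to (iff u w) eq₁
    ... | inj₁ e = inj₁ e
    ... | inj₂ (inj₁ (a , c)) = inj₂ (inj₁ (there a , c))
    ... | inj₂ (inj₂ (a , c)) = inj₂ (inj₂ (a , there c))

    old : ∀ u w → ed u w ≡ true ⊎ Linked ls j lab u w → joinEdge i j lab ed′ u w ≡ true
    old u w p rewrite Equivalence.from (iff u w) p = refl

    from : ∀ u w → ed u w ≡ true ⊎ Linked (i ∷ ls) j lab u w →
           joinEdge i j lab ed′ u w ≡ true
    from u w (inj₁ e) = old u w (inj₁ e)
    from u w (inj₂ (inj₁ (there a , c))) = old u w (inj₂ (inj₁ (a , c)))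
    from u w (inj₂ (inj₂ (a , there c))) = old u w (inj₂ (inj₂ (a , c)))
    from u w (inj₂ (inj₁ (here a , c))) = ∨⁺ʳ (ed′ u w)
      (cong (_∨ (⌊ lab u ≟ j ⌋ ∧ ⌊ lab w ≟ i ⌋)) (both⁺ (lab u ≟ i) (lab w ≟ j) a c))
    from u w (inj₂ (inj₂ (a , here c))) = ∨⁺ʳ (ed′ u w)
      (∨⁺ʳ (⌊ lab u ≟ i ⌋ ∧ _) (both⁺ (lab u ≟ j) (lab w ≟ i) a c))

  relabelB : ∀ i j → Built U lab ed → Built U (move i j ∘ lab) ed
  relabelB {lab = lab} i j b = record
    { Built b hiding (expr; label-≡)
    ; expr = relabel i j expr
    ; label-≡ = label′ }
    where
    open Built b
    label′ : ∀ x → label (relabel i j expr) x ≡ move i j (lab (pos x))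
    label′ x rewrite sym (label-≡ x) with label expr x ≟ i
    ... | yes _ = refl
    ... | no _  = refl

  moveAll : (V → Fin K) → (V → Fin K) → List V → Fin K → Fin K
  moveAll src tgt us c = foldr (λ u → move (src u) (tgt u)) c us

  relabelAll : ∀ src tgt us → Built U lab ed → Built U (moveAll src tgt us ∘ lab) ed
  relabelAll src tgt []       b = b
  relabelAll src tgt (u ∷ us) b = relabelB (src u) (tgt u) (relabelAll src tgt us b)

  module _ (src tgt : V → Fin K) (disj : ∀ u w → tgt w ≢ src u) where

    moveAll-tgt : ∀ us w → moveAll src tgt us (tgt w) ≡ tgt w
    moveAll-tgt []       w = refl
    moveAll-tgt (u ∷ us) w rewrite moveAll-tgt us w = move-≢ (disj u w)

    -- Once renamed, a label is a target, and `disj` keeps all later renamings away from it; until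
    -- then it is intact. By `fun` it does not matter which vertex carrying the label triggers the
    -- renaming.
    moveAll-src : (∀ u w → src u ≡ src w → tgt u ≡ tgt w) → ∀ us w →
      (moveAll src tgt us (src w) ≡ src w × w ∉ us) ⊎ moveAll src tgt us (src w) ≡ tgt w
    moveAll-src fun [] w = inj₁ (refl , λ ())
    moveAll-src fun (u ∷ us) w with moveAll-src fun us w
    ... | inj₂ eq rewrite eq = inj₂ (move-≢ (disj u w))
    ... | inj₁ (eq , w∉) rewrite eq with src u ≟ src w
    ...   | yes p rewrite p = inj₂ (trans (move-≡ (src w) (tgt u)) (fun u w p))
    ...   | no ¬p = inj₁ (move-≢ (¬p ∘ sym) ,
                       λ { (here refl) → ¬p refl ; (there w∈) → w∉ w∈ })

    moveAll-∈ : (∀ u w → src u ≡ src w → tgt u ≡ tgt w) → ∀ {us w} → w ∈ us →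
      moveAll src tgt us (src w) ≡ tgt w
    moveAll-∈ fun {us} {w} w∈ with moveAll-src fun us w
    ... | inj₁ (_ , w∉) = contradiction w∈ w∉
    ... | inj₂ eq = eq

-- From vertex orders with small cuts to clique-width expressions

module _ (G : Graph) where

  private
    V = Fin (n G)

  -- Boundedly many neighbourhoods outside `U`, encoded by a labelling rather than a count:
  -- different labels may still have the same neighbourhood.
  Cut : ℕ → List V → Set
  Cut k U = Σ (V → Fin k) λ ℓ → ∀ {u u′} → u ∈ U → u′ ∈ U → ℓ u ≡ ℓ u′ →
            ∀ w → w ∉ U → adj G u w ≡ adj G u′ w

  data Order (k : ℕ) : List V → Set where
    []  : Order k []
    place : ∀ {v U} → v ∉ U → Cut k (v ∷ U) → Order k U → Order k (v ∷ U)

  private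
    -- Labels come in two banks, so that a whole bank can be renamed into the
    -- other one label at a time without collisions.
    bank : ∀ {k} → Fin 2 → Fin k → Fin (2 * k)
    bank = combine

    other : Fin 2 → Fin 2
    other zero    = suc zero
    other (suc _) = zero

    other-≢ : ∀ b → other b ≢ b
    other-≢ zero       ()
    other-≢ (suc zero) ()

    bank-≢ : ∀ {k} b (c d : Fin k) → bank (other b) c ≢ bank b d
    bank-≢ b c d eq = other-≢ b (combine-injectiveˡ (other b) c b d eq)

  -- The labels in use form a cut, so vertices sharing a label never have to be told apart again.
  -- They all lie in bank `b`, and the other bank is free.
  record State (k : ℕ) (U : List V) : Set where
    field
      b     : Fin 2
      cut   : Cut k U
      built : Built U (bank b ∘ proj₁ cut) (adj G)

  start : ∀ {k v} → Cut k (v ∷ []) → State k (v ∷ [])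
  start {v = v} cut = record
    { b = zero
    ; cut = cut
    ; built = resp (λ _ → refl) (λ { (here refl) (here refl) → sym (irrefl G v) }) (single v) }

  -- The new vertex takes a label from the free bank and is joined to the labels of its neighbours.
  -- Then the old bank is renamed into the free one, merging classes as the next cut allows.
  extend : ∀ {k v U} → v ∉ U → Cut k (v ∷ U) → State k U → State k (v ∷ U)
  extend {k} {v} {U} v∉U (ℓ⁺ , ok⁺) st = record
    { b = other b
    ; cut = ℓ′ , ok′
    ; built = resp final-lab final-ed (relabelAll src tgt U (proj₁ (proj₂ joined))) }
    where
    open State st
    ℓ  = proj₁ cut
    ok = proj₂ cut

    rep : Fin k → V
    rep i with Any.any? (λ u → ℓ u ≟ i) U
    ... | yes p = Any.lookup p
    ... | no _  = v

    rep-ok : ∀ {u} → u ∈ U → rep (ℓ u) ∈ U × ℓ (rep (ℓ u)) ≡ ℓ u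
    rep-ok {u} u∈U with Any.any? (λ w → ℓ w ≟ ℓ u) U
    ... | yes p = ∈-lookup (Any.index p) , lookup-result p
    ... | no ¬p = contradiction (Any.map (λ { refl → refl }) u∈U) ¬p

    rep⁺ : V → V
    rep⁺ = v ↦ v else (rep ∘ ℓ)

    rep⁺-U : ∀ {u} → u ∈ U → rep⁺ u ≡ rep (ℓ u)
    rep⁺-U u∈U = ↦-other v v (rep ∘ ℓ) (λ { refl → v∉U u∈U })

    rep⁺-v : rep⁺ v ≡ v
    rep⁺-v = ↦-same v

    rep⁺-ok : ∀ {u} → u ∈ v ∷ U → rep⁺ u ∈ v ∷ U ×
              (∀ w → w ∉ v ∷ U → adj G u w ≡ adj G (rep⁺ u) w)
    rep⁺-ok (here refl) rewrite rep⁺-v = here refl , λ _ _ → refl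
    rep⁺-ok (there u∈U) rewrite rep⁺-U u∈U = there (proj₁ (rep-ok u∈U)) ,
      λ w w∉ → ok u∈U (proj₁ (rep-ok u∈U)) (sym (proj₂ (rep-ok u∈U))) w (w∉ ∘ there)

    ℓ′ : V → Fin k
    ℓ′ = ℓ⁺ ∘ rep⁺

    ok′ : ∀ {u u′} → u ∈ v ∷ U → u′ ∈ v ∷ U → ℓ′ u ≡ ℓ′ u′ →
          ∀ w → w ∉ v ∷ U → adj G u w ≡ adj G u′ w
    ok′ u∈ u′∈ eq w w∉ = trans (proj₂ (rep⁺-ok u∈) w w∉)
      (trans (ok⁺ (proj₁ (rep⁺-ok u∈)) (proj₁ (rep⁺-ok u′∈)) eq w w∉)
             (sym (proj₂ (rep⁺-ok u′∈) w w∉)))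

    new = bank (other b) (ℓ′ v)

    lab₁ : V → Fin (2 * k)
    lab₁ = v ↦ new else (bank b ∘ ℓ)

    ed₁ : V → V → Bool
    ed₁ u w with u ≟ v | w ≟ v
    ... | no _ | no _ = adj G u w
    ... | _    | _    = false

    lab₁-v : lab₁ v ≡ new
    lab₁-v = ↦-same v

    lab₁-U : ∀ {u} → u ∈ U → lab₁ u ≡ bank b (ℓ u)
    lab₁-U u∈U = ↦-other v new (bank b ∘ ℓ) (λ { refl → v∉U u∈U })

    ed₁-v : ∀ w → ed₁ v w ≡ false
    ed₁-v w with v ≟ v | w ≟ v
    ... | yes _ | _ = refl
    ... | no ≢  | _ = contradiction refl ≢

    ed₁-v′ : ∀ w → ed₁ w v ≡ false
    ed₁-v′ w with w ≟ v | v ≟ v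
    ... | yes _ | _     = refl
    ... | no _  | yes _ = refl
    ... | no _  | no ≢  = contradiction refl ≢

    ed₁-U : ∀ {u w} → u ∈ U → w ∈ U → ed₁ u w ≡ adj G u w
    ed₁-U {u} {w} u∈U w∈U with u ≟ v | w ≟ v
    ... | yes refl | _        = contradiction u∈U v∉U
    ... | no _     | yes refl = contradiction w∈U v∉U
    ... | no _     | no _     = refl

    added : Built (v ∷ U) lab₁ ed₁
    added = add v∉U ed₁-v ed₁-v′
      (resp (λ u∈ → sym (lab₁-U u∈)) (λ u∈ w∈ → sym (ed₁-U u∈ w∈)) built)

    nbr? : ∀ u → Dec (adj G u v ≡ true)
    nbr? u = adj G u v ≟ᵇ true

    ls = map (bank b ∘ ℓ) (filter nbr? U)

    -- Since `v` lies outside `U`, the cut makes a label class with one neighbour of `v` consist of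
    -- neighbours of `v` only.
    ∈ls⇔ : ∀ {u} → u ∈ U → bank b (ℓ u) ∈ ls ⇔ adj G u v ≡ true
    ∈ls⇔ {u} u∈U = mk⇔ to (λ e → ∈-map⁺ _ (∈-filter⁺ nbr? u∈U e))
      where
      to : bank b (ℓ u) ∈ ls → adj G u v ≡ true
      to m with ∈-map⁻ _ m
      ... | w , w∈ , eq with ∈-filter⁻ nbr? {xs = U} w∈
      ...   | w∈U , e = trans (ok u∈U w∈U (combine-injectiveʳ b (ℓ u) b (ℓ w) eq) v v∉U) e

    new∉ : new ∉ ls
    new∉ m with ∈-map⁻ _ m
    ... | w , _ , eq = bank-≢ b _ _ eq

    joined = joinAll ls new∉ added

    joined-≡ : ∀ {u w} → u ∈ v ∷ U → w ∈ v ∷ U → proj₁ joined u w ≡ adj G u w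
    joined-≡ u∈ w∈ = ⇔→≡ (mk⇔ (λ e → to u∈ w∈ (Equivalence.to (proj₂ (proj₂ joined) _ _) e))
                              (λ e → Equivalence.from (proj₂ (proj₂ joined) _ _) (from u∈ w∈ e)))
      where
      to : ∀ {u w} → u ∈ v ∷ U → w ∈ v ∷ U →
           ed₁ u w ≡ true ⊎ Linked ls new lab₁ u w → adj G u w ≡ true
      to (here refl) _ (inj₁ e) = contradiction (trans (sym (ed₁-v _)) e) λ ()
      to {u} (there _) (here refl) (inj₁ e) = contradiction (trans (sym (ed₁-v′ u)) e) λ ()
      to (there u∈) (there w∈) (inj₁ e) = trans (sym (ed₁-U u∈ w∈)) e
      to _ (there w∈) (inj₂ (inj₁ (_ , q))) = contradiction (trans (sym q) (lab₁-U w∈)) (bank-≢ b _ _)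
      to (here refl) (here refl) (inj₂ (inj₁ (p , _))) = contradiction (subst (_∈ ls) lab₁-v p) new∉
      to (there u∈) (here refl) (inj₂ (inj₁ (p , _))) =
        Equivalence.to (∈ls⇔ u∈) (subst (_∈ ls) (lab₁-U u∈) p)
      to (there u∈) _ (inj₂ (inj₂ (q , _))) = contradiction (trans (sym q) (lab₁-U u∈)) (bank-≢ b _ _)
      to (here refl) (here refl) (inj₂ (inj₂ (_ , p))) = contradiction (subst (_∈ ls) lab₁-v p) new∉
      to (here refl) (there w∈) (inj₂ (inj₂ (_ , p))) =
        trans (adj-sym G _ _) (Equivalence.to (∈ls⇔ w∈) (subst (_∈ ls) (lab₁-U w∈) p))

      from : ∀ {u w} → u ∈ v ∷ U → w ∈ v ∷ U → adj G u w ≡ true →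
             ed₁ u w ≡ true ⊎ Linked ls new lab₁ u w
      from (here refl) (here refl) e = contradiction (trans (sym (irrefl G _)) e) λ ()
      from (here refl) (there w∈) e = inj₂ (inj₂ (lab₁-v ,
        subst (_∈ ls) (sym (lab₁-U w∈)) (Equivalence.from (∈ls⇔ w∈) (trans (adj-sym G _ _) e))))
      from (there u∈) (here refl) e = inj₂ (inj₁ (
        subst (_∈ ls) (sym (lab₁-U u∈)) (Equivalence.from (∈ls⇔ u∈) e) , lab₁-v))
      from (there u∈) (there w∈) e = inj₁ (trans (ed₁-U u∈ w∈) e)

    src tgt : V → Fin (2 * k)
    src = bank b ∘ ℓ
    tgt = bank (other b) ∘ ℓ⁺ ∘ rep ∘ ℓ

    final-lab : ∀ {u} → u ∈ v ∷ U → moveAll src tgt U (lab₁ u) ≡ bank (other b) (ℓ′ u)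
    final-lab (here refl) rewrite lab₁-v = stays U
      where
      stays : ∀ us → moveAll src tgt us new ≡ new
      stays []       = refl
      stays (u ∷ us) rewrite stays us = move-≢ (bank-≢ b (ℓ′ v) (ℓ u))
    final-lab {u} (there u∈) rewrite lab₁-U u∈ | rep⁺-U u∈ =
      moveAll-∈ src tgt (λ u w → bank-≢ b (ℓ⁺ (rep (ℓ w))) (ℓ u))
        (λ u w eq → cong (bank (other b) ∘ ℓ⁺ ∘ rep) (combine-injectiveʳ b (ℓ u) b (ℓ w) eq)) u∈

    final-ed : ∀ {u w} → u ∈ v ∷ U → w ∈ v ∷ U → proj₁ joined u w ≡ adj G u w
    final-ed = joined-≡

  build : ∀ {k v U} → Order k (v ∷ U) → State k (v ∷ U)
  build (place _ cut [])               = start cut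
  build (place v∉U cut o@(place _ _ _)) = extend v∉U cut (build o)

  -- The factor 2 pays for the two banks. An expression has at least one vertex, so the null graph
  -- is treated separately.
  order⇒cw : ∀ {k U} → Order k U → (∀ v → v ∈ U) → CWAtMost (2 * k) G
  order⇒cw {k} {[]} _ all∈ = inj₁ (empty (n G) all∈)
    where
    empty : ∀ m → ((v : Fin m) → v ∈ []) → m ≡ 0
    empty zero    _ = refl
    empty (suc m) h with h zero
    ... | ()
  order⇒cw {k} {_ ∷ _} o all∈ = inj₂ (2 * k , ≤-refl , expr ,
    mk↔ₛ′ pos (λ v → proj₁ (pos-onto (all∈ v))) (λ v → proj₂ (pos-onto (all∈ v)))
      (λ x → pos-inj (proj₂ (pos-onto (all∈ (pos x))))) ,
    λ x y → sym (edge-≡ x y))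
    where open Built (State.built (build o))

-- Lists without repetition, and choosing between two values

module _ {A : Set} where

  lookup-injective : ∀ {xs : List A} → Unique xs → ∀ {i j} → lookup xs i ≡ lookup xs j → i ≡ j
  lookup-injective (_ ∷ _)  {zero}  {zero}  _  = refl
  lookup-injective (x≢ ∷ _) {zero}  {suc j} eq = contradiction eq (All.lookup x≢ (∈-lookup j))
  lookup-injective (x≢ ∷ _) {suc i} {zero}  eq = contradiction (sym eq) (All.lookup x≢ (∈-lookup i))
  lookup-injective (_ ∷ u)  {suc i} {suc j} eq = cong suc (lookup-injective u eq)

  unique-⊆⇒length≤ : ∀ {xs ys : List A} → Unique xs → (∀ {x} → x ∈ xs → x ∈ ys) →
                     length xs ≤ length ys
  unique-⊆⇒length≤ u sub = injective⇒≤ {f = λ i → index (sub (∈-lookup i))} λ {i} {j} eq →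
    lookup-injective u (SetoidMembership.index-injective (setoid A) (sub (∈-lookup i)) (sub (∈-lookup j)) eq)

  -- Bookkeeping for "at most two": once one of two candidates is used up, a single one is left.
  drop-one : ∀ {a b p : A} → p ≡ a ⊎ p ≡ b → ∃ λ c → ∀ {x} → x ≢ p → x ≡ a ⊎ x ≡ b → x ≡ c
  drop-one {b = b} (inj₁ refl) = b , λ { ≢ (inj₁ eq) → contradiction eq ≢ ; _ (inj₂ eq) → eq }
  drop-one {a = a} (inj₂ refl) = a , λ { _ (inj₁ eq) → eq ; ≢ (inj₂ eq) → contradiction eq ≢ }

-- Vertex orders with small cuts

module Ordering (G : Graph) where

  V : Set
  V = Fin (n G)

  open DecMembership {A = V} _≟_ public using (_∈?_)

  infix 4 _~_ _#_
  _~_ _#_ : V → V → Set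
  u ~ v = adj G u v ≡ true
  u # v = u ≢ v × adj G u v ≡ false

  _~?_ : ∀ u v → Dec (u ~ v)
  u ~? v = adj G u v ≟ᵇ true

  ~-sym : ∀ {u v} → u ~ v → v ~ u
  ~-sym {u} {v} = trans (adj-sym G v u)

  ~⇒≢ : ∀ {u v} → u ~ v → u ≢ v
  ~⇒≢ {u} e refl = contradiction (trans (sym e) (irrefl G u)) λ ()

  data Rel (u v : V) : Set where
    same : u ≡ v → Rel u v
    near : u ~ v → Rel u v
    far  : u # v → Rel u v

  rel : ∀ u v → Rel u v
  rel u v with u ≟ v | adj G u v in eq
  ... | yes u≡v | _     = same u≡v
  ... | no _    | true  = near eq
  ... | no u≢v  | false = far (u≢v , eq)

  Cluster : (V → Set) → Set
  Cluster P = ∀ {x y z} → P x → P y → P z → x ~ y → y ~ z → ¬ x # z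

  order-unique : ∀ {k U} → Order G k U → Unique U
  order-unique []             = []
  order-unique (place v∉ _ o) = All.tabulate (λ { u∈ refl → v∉ u∈ }) ∷ order-unique o

  unique-length≤ : ∀ {U : List V} → Unique U → length U ≤ n G
  unique-length≤ u = ≤-trans (unique-⊆⇒length≤ u (λ {x} _ → ∈-allFin x))
                             (≤-reflexive (length-tabulate id))

  module _ {k : ℕ} (Good : List V → Set) (cut : ∀ {U} → Good U → Cut G k U)
           (step : ∀ {U v} → Good U → v ∉ U → ∃ λ w → w ∉ U × Good (w ∷ U)) where

    -- Greedy extension, where `step` may add another vertex than the missing one it is given. The
    -- fuel `m` bounds the number of missing vertices, so at `zero` a further vertex would give more
    -- than `n G` distinct ones.
    complete : ∀ m {U} → n G ≤ m + length U → Order G k U → Good U →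
               ∃ λ U′ → Order G k U′ × (∀ v → v ∈ U′)
    complete m {U} n≤ o g with any? (λ v → ¬? (v ∈? U))
    ... | no ¬∃ = U , o , all∈
      where
      all∈ : ∀ v → v ∈ U
      all∈ v with v ∈? U
      ... | yes v∈ = v∈
      ... | no v∉  = contradiction (v , v∉) ¬∃
    complete zero n≤ o g | yes (v , v∉) with step g v∉
    ... | w , w∉ , g′ = contradiction
      (≤-trans (unique-length≤ (order-unique (place w∉ (cut g′) o))) n≤) (n≮n _)
    complete (suc m) n≤ o g | yes (v , v∉) with step g v∉
    ... | w , w∉ , g′ = complete m (≤-trans n≤ (≤-reflexive (sym (+-suc m _))))
                                   (place w∉ (cut g′) o) g′

  ResidualCut : List V → ℕ → List V → Set
  ResidualCut S m U = Σ (V → Fin m) λ ℓ → ∀ {u u′} → u ∈ U → u′ ∈ U → u ∉ S → u′ ∉ S →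
    ℓ u ≡ ℓ u′ → ∀ w → w ∉ U → adj G u w ≡ adj G u′ w

  -- Each vertex of `S` receives a label of its own, its index in `S`; hence setting `S` aside costs
  -- `length S` labels.
  residual⇒cut : ∀ {S m U} → ResidualCut S m U → Cut G (length S + m) U
  residual⇒cut {S} {m} {U} (ℓ , ok) = ℓ′ , ok′
    where
    ℓ′ : V → Fin (length S + m)
    ℓ′ u with u ∈? S
    ... | yes u∈ = index u∈ ↑ˡ m
    ... | no _   = length S ↑ʳ ℓ u

    ↑ˡ≢↑ʳ : ∀ i j → i ↑ˡ m ≢ length S ↑ʳ j
    ↑ˡ≢↑ʳ i j eq with trans (sym (splitAt-↑ˡ (length S) i m))
                     (trans (cong (splitAt (length S)) eq) (splitAt-↑ʳ (length S) m j))
    ... | ()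

    ok′ : ∀ {u u′} → u ∈ U → u′ ∈ U → ℓ′ u ≡ ℓ′ u′ → ∀ w → w ∉ U → adj G u w ≡ adj G u′ w
    ok′ {u} {u′} u∈ u′∈ eq w w∉ with u ∈? S | u′ ∈? S
    ... | yes p | yes q = cong (λ x → adj G x w)
      (SetoidMembership.index-injective (setoid V) p q (↑ˡ-injective m _ _ eq))
    ... | yes _ | no _  = contradiction eq (↑ˡ≢↑ʳ _ _)
    ... | no _  | yes _ = contradiction (sym eq) (↑ˡ≢↑ʳ _ _)
    ... | no p  | no q  = ok u∈ u′∈ p q (↑ʳ-injective (length S) _ _ eq) w w∉

  module Around (S : List V) (m : ℕ) (ℓ₀ : V → Fin m) where

    -- `S` is placed first, and any order will do, as a residual cut asks nothing of vertices in
    -- `S`. The membership test skips repetitions.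
    seed : ∀ T → (∀ {v} → v ∈ T → v ∈ S) →
      ∃ λ U → Order G (length S + m) U × (∀ {v} → v ∈ U → v ∈ S) × (∀ {v} → v ∈ T → v ∈ U)
    seed [] _ = [] , [] , (λ ()) , λ ()
    seed (t ∷ T) T⊆S with seed T (T⊆S ∘ there)
    ... | U , o , U⊆S , T⊆U with t ∈? U
    ...   | yes t∈ = U , o , U⊆S , λ { (here refl) → t∈ ; (there v∈) → T⊆U v∈ }
    ...   | no t∉ = t ∷ U , place t∉ (residual⇒cut (ℓ₀ , λ u∈ _ u∉ → contradiction (U′⊆S u∈) u∉)) o ,
        U′⊆S , λ { (here refl) → here refl ; (there v∈) → there (T⊆U v∈) }
      where
      U′⊆S : ∀ {v} → v ∈ t ∷ U → v ∈ S
      U′⊆S (here refl) = T⊆S (here refl)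
      U′⊆S (there v∈)  = U⊆S v∈

    arrange : (Good : List V → Set) →
      (∀ {U} → (∀ {v} → v ∈ U → v ∈ S) → Good U) →
      (∀ {U} → (∀ {s} → s ∈ S → s ∈ U) → Good U → ResidualCut S m U) →
      (∀ {U v} → (∀ {s} → s ∈ S → s ∈ U) → Good U → v ∉ U → ∃ λ w → w ∉ U × Good (w ∷ U)) →
      CWAtMost (2 * (length S + m)) G
    arrange Good good₀ cut step with seed S id
    ... | U , o , U⊆S , S⊆U with complete (λ U → (∀ {s} → s ∈ S → s ∈ U) × Good U)
            (λ (S⊆ , g) → residual⇒cut (cut S⊆ g))
            (λ (S⊆ , g) v∉ → let w , w∉ , g′ = step S⊆ g v∉ in w , w∉ , there ∘ S⊆ , g′)
            (n G) (m≤m+n (n G) (length U)) o (S⊆U , good₀ U⊆S)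
    ...   | _ , o′ , all∈ = order⇒cw G o′ all∈

  -- A clique is finished before the next one is started, so at most one clique is
  -- split by the current cut.
  cluster⇒cw : ∀ S → Cluster (_∉ S) → CWAtMost (2 * (length S + 2)) G
  cluster⇒cw S cluster = Around.arrange S 2 (λ _ → zero) Good good₀ cut step
    where
    Open : List V → V → Set
    Open U u = ∃ λ w → w ∉ U × u ~ w

    open? : ∀ U u → Dec (Open U u)
    open? U u = any? λ w → ¬? (w ∈? U) ×-dec (u ~? w)

    Good : List V → Set
    Good U = ∀ {u u′} → u ∈ U → u′ ∈ U → u ∉ S → u′ ∉ S → Open U u → Open U u′ → ¬ u # u′

    good₀ : ∀ {U} → (∀ {v} → v ∈ U → v ∈ S) → Good U
    good₀ U⊆S u∈ _ u∉ = contradiction (U⊆S u∈) u∉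

    close : ∀ {x y z} → x ∉ S → y ∉ S → z ∉ S → x ~ y → y ~ z → x ≢ z → x ~ z
    close {x} {y} {z} x∉ y∉ z∉ xy yz x≢z with rel x z
    ... | same eq = contradiction eq x≢z
    ... | near xz = xz
    ... | far xz  = contradiction xz (cluster x∉ y∉ z∉ xy yz)

    step : ∀ {U v} → (∀ {s} → s ∈ S → s ∈ U) → Good U → v ∉ U → ∃ λ w → w ∉ U × Good (w ∷ U)
    step {U} {v} S⊆U g v∉ with any? (λ u → (u ∈? U) ×-dec ¬? (u ∈? S) ×-dec open? U u)
    ... | no ¬∃ = v , v∉ , g′
      where
      g′ : Good (v ∷ U)
      g′ (here refl) (here refl) _ _ _ _ (≢ , _) = ≢ refl
      g′ (there u∈) _ u∉ _ (w , w∉ , uw) _ _ = ¬∃ (_ , u∈ , u∉ , w , w∉ ∘ there , uw)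
      g′ (here refl) (there u∈) _ u∉ _ (w , w∉ , uw) _ = ¬∃ (_ , u∈ , u∉ , w , w∉ ∘ there , uw)
    ... | yes (u₀ , u₀∈ , u₀∉ , w₀ , w₀∉ , u₀w₀) = w₀ , w₀∉ , g′
      where
      w₀∉S : w₀ ∉ S
      w₀∉S = w₀∉ ∘ S⊆U

      new : ∀ {u} → u ∈ U → u ∉ S → Open (w₀ ∷ U) u → ¬ u # w₀
      new {u} u∈ u∉ (w , w∉ , uw) far′ with rel u u₀
      ... | same refl = contradiction (trans (sym u₀w₀) (proj₂ far′)) λ ()
      ... | near uu₀ = cluster u∉ u₀∉ w₀∉S uu₀ u₀w₀ far′
      ... | far uu₀  = g u∈ u₀∈ u∉ u₀∉ (w , w∉ ∘ there , uw) (w₀ , w₀∉ , u₀w₀) uu₀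

      g′ : Good (w₀ ∷ U)
      g′ (here refl) (here refl) _ _ _ _ (≢ , _) = ≢ refl
      g′ (there u∈) (here refl) u∉ _ o _ f = new u∈ u∉ o f
      g′ (here refl) (there u∈) _ u∉ _ o (≢ , e) = new u∈ u∉ o (≢ ∘ sym , trans (adj-sym G _ _) e)
      g′ (there u∈) (there u′∈) u∉ u′∉ (w , w∉ , e) (w′ , w′∉ , e′) =
        g u∈ u′∈ u∉ u′∉ (w , w∉ ∘ there , e) (w′ , w′∉ ∘ there , e′)

    cut : ∀ {U} → (∀ {s} → s ∈ S → s ∈ U) → Good U → ResidualCut S 2 U
    cut {U} S⊆U g = ℓ , ok
      where
      -- Two labels suffice: a vertex that is not open has no unplaced neighbour, and the open ones
      -- lie in one clique and all see exactly its unplaced part.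
      ℓ : V → Fin 2
      ℓ u with open? U u
      ... | yes _ = suc zero
      ... | no _  = zero

      ok : ∀ {u u′} → u ∈ U → u′ ∈ U → u ∉ S → u′ ∉ S → ℓ u ≡ ℓ u′ →
           ∀ w → w ∉ U → adj G u w ≡ adj G u′ w
      ok {u} {u′} u∈ u′∈ u∉ u′∉ eq w w∉ with open? U u | open? U u′
      ... | no ¬p | no ¬q = trans (shut ¬p) (sym (shut ¬q))
        where
        shut : ∀ {x} → ¬ Open U x → adj G x w ≡ false
        shut {x} ¬o with adj G x w in e
        ... | true  = contradiction (w , w∉ , e) ¬o
        ... | false = refl
      ... | yes p | yes q = agree
        where
        ≢w : ∀ {x} → x ∈ U → x ≢ w
        ≢w x∈ refl = w∉ x∈

        agree : adj G u w ≡ adj G u′ w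
        agree with rel u u′
        ... | same refl = refl
        ... | far f     = contradiction f (g u∈ u′∈ u∉ u′∉ p q)
        ... | near uu′  = ⇔→≡ (mk⇔
          (λ e → close u′∉ u∉ (w∉ ∘ S⊆U) (~-sym uu′) e (≢w u′∈))
          (λ e → close u∉ u′∉ (w∉ ∘ S⊆U) uu′ e (≢w u∈)))

  module _ (S : List V) (cl : V → Fin 3) (φ : Fin 3 → Fin 3 → Bool)
           (φ-sym : ∀ i j → φ i j ≡ φ j i) where

    -- The edges of the graph obtained by complementing inside and between the classes of `cl`
    -- wherever `φ` is true.
    Exceptional : V → V → Set
    Exceptional u w = u ≢ w × adj G u w ≢ φ (cl u) (cl w)

    exceptional? : ∀ u w → Dec (Exceptional u w)
    exceptional? u w = ¬? (u ≟ w) ×-dec ¬? (adj G u w ≟ᵇ φ (cl u) (cl w))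

    exceptional-sym : ∀ {u w} → Exceptional u w → Exceptional w u
    exceptional-sym {u} {w} (≢ , ex) = ≢ ∘ sym ,
      λ eq → ex (trans (adj-sym G u w) (trans eq (φ-sym (cl w) (cl u))))

    exceptional-agree : ∀ {u u′ w} → u ≢ w → u′ ≢ w → cl u ≡ cl u′ →
      (Exceptional u w → Exceptional u′ w) → (Exceptional u′ w → Exceptional u w) →
      adj G u w ≡ adj G u′ w
    exceptional-agree {u} {u′} {w} u≢w u′≢w cl≡ to from
      with adj G u w ≟ᵇ φ (cl u) (cl w) | adj G u′ w ≟ᵇ φ (cl u′) (cl w)
    ... | yes p | yes q = trans p (trans (cong (λ c → φ c (cl w)) cl≡) (sym q))
    ... | yes p | no q  = contradiction p (proj₂ (from (u′≢w , q)))
    ... | no p  | yes q = contradiction q (proj₂ (to (u≢w , p)))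
    ... | no p  | no q  = trans (¬-not p) (trans (cong (λ c → not (φ c (cl w))) cl≡) (sym (¬-not q)))

    -- The exceptional pairs form a graph of maximum degree 2, whose vertices are
    -- listed path by path: at most two of its edges cross the current cut.
    flip⇒cw : V →
      (∀ {v} → v ∉ S → ∃₂ λ a b → ∀ {w} → w ∉ S → Exceptional v w → w ≡ a ⊎ w ≡ b) →
      CWAtMost (2 * (length S + 12)) G
    flip⇒cw v₀ deg = Around.arrange S 12 (λ _ → zero) Good good₀ cut step
      where
      Crossing : List V → V × V → Set
      Crossing U (u , w) = u ∈ U × u ∉ S × w ∉ U × Exceptional u w

      Good : List V → Set
      Good U = ∃₂ λ d e → ∀ {p} → Crossing U p → p ≡ d ⊎ p ≡ e

      good₀ : ∀ {U} → (∀ {v} → v ∈ U → v ∈ S) → Good U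
      good₀ U⊆S = (v₀ , v₀) , (v₀ , v₀) , λ (u∈ , u∉ , _) → contradiction (U⊆S u∈) u∉

      crossing? : ∀ U u → Dec (∃ λ w → Crossing U (u , w))
      crossing? U u = any? λ w → (u ∈? U) ×-dec ¬? (u ∈? S) ×-dec ¬? (w ∈? U) ×-dec exceptional? u w

      step : ∀ {U v} → (∀ {s} → s ∈ S → s ∈ U) → Good U → v ∉ U → ∃ λ w → w ∉ U × Good (w ∷ U)
      step {U} {v} S⊆U (d , e , only) v∉ with any? (crossing? U)
      ... | no ¬∃ with deg (v∉ ∘ S⊆U)
      ...   | a , b , nbrs = v , v∉ , (v , a) , (v , b) , λ
        { (here refl , _ , w∉ , ex) → [ inj₁ ∘ cong (v ,_) , inj₂ ∘ cong (v ,_) ]′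
            (nbrs (w∉ ∘ there ∘ S⊆U) ex)
        ; (there u∈ , u∉ , w∉ , ex) → contradiction (_ , _ , u∈ , u∉ , w∉ ∘ there , ex) ¬∃ }
      step {U} {v} S⊆U (d , e , only) v∉ | yes (u₀ , w₀ , cr₀@(u₀∈ , u₀∉ , w₀∉ , ex₀))
        with deg (w₀∉ ∘ S⊆U)
      -- Placing `w₀` uses up one of the two crossing pairs and leaves `f`. One of the two
      -- exceptional neighbours of `w₀` is the placed `u₀`, so at most one new pair, `(w₀ , c)`,
      -- arises.
      ... | a , b , nbrs with drop-one (only cr₀) | drop-one (nbrs u₀∉ (exceptional-sym ex₀))
      ...   | f , only′ | c , nbrs′ = w₀ , w₀∉ , f , (w₀ , c) , λ
        { (here refl , _ , w∉ , ex) → inj₂ (cong (w₀ ,_)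
            (nbrs′ (λ { refl → w∉ (there u₀∈) }) (nbrs (w∉ ∘ there ∘ S⊆U) ex)))
        ; (there u∈ , u∉ , w∉ , ex) → inj₁ (only′ (λ { refl → w∉ (here refl) })
            (only (u∈ , u∉ , w∉ ∘ there , ex))) }

      bit : ∀ {A : Set} → Dec A → Fin 2
      bit (yes _) = suc zero
      bit (no _)  = zero

      bit-≡ : ∀ {A B : Set} (p : Dec A) (q : Dec B) → bit p ≡ bit q → A → B
      bit-≡ _       (yes b) _  _ = b
      bit-≡ (no ¬a) (no _)  _  a = contradiction a ¬a
      bit-≡ (yes _) (no _)  () _

      cut : ∀ {U} → (∀ {s} → s ∈ S → s ∈ U) → Good U → ResidualCut S 12 U
      cut {U} _ ((_ , a) , (_ , b) , only) = ℓ , ok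
        where
        -- Only `a` and `b` can be unplaced ends of crossing pairs. A class and one bit for each of
        -- them determine all adjacencies across the cut, whence 12 = 3 · 2 · 2 labels.
        β : V → V → Fin 2
        β p u = bit (exceptional? u p)

        bits : V → Fin 4
        bits u = combine (β a u) (β b u)

        ℓ : V → Fin 12
        ℓ u = combine (cl u) (bits u)

        transfer : ∀ {u u′ w} → u ∈ U → u ∉ S → w ∉ U → ℓ u ≡ ℓ u′ →
                   Exceptional u w → Exceptional u′ w
        transfer {u} {u′} u∈ u∉ w∉ eq ex
          with combine-injective (β a u) (β b u) (β a u′) (β b u′) (proj₂ (combine-injective (cl u) (bits u) (cl u′) (bits u′) eq))
             | only (u∈ , u∉ , w∉ , ex)
        ... | eqa , _ | inj₁ refl = bit-≡ (exceptional? u a) (exceptional? u′ a) eqa ex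
        ... | _ , eqb | inj₂ refl = bit-≡ (exceptional? u b) (exceptional? u′ b) eqb ex

        ok : ∀ {u u′} → u ∈ U → u′ ∈ U → u ∉ S → u′ ∉ S → ℓ u ≡ ℓ u′ →
             ∀ w → w ∉ U → adj G u w ≡ adj G u′ w
        ok {u} {u′} u∈ u′∈ u∉ u′∉ eq w w∉ = exceptional-agree
          (λ { refl → w∉ u∈ }) (λ { refl → w∉ u′∈ })
          (proj₁ (combine-injective (cl u) (bits u) (cl u′) (bits u′) eq))
          (transfer u∈ u∉ w∉ eq) (transfer u′∈ u′∉ w∉ (sym eq))

-- Exhibiting induced subgraphs, and counting for Ramsey's theorem

mkInduced : ∀ H G (f : Fin (n H) → Fin (n G)) →
  (∀ i j → i <ᶠ j → f i ≢ f j × adj G (f i) (f j) ≡ adj H i j) → InducedSub H G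
mkInduced H G f ok = f , inj , edges
  where
  inj : ∀ {i j} → f i ≡ f j → i ≡ j
  inj {i} {j} eq with <-cmp i j
  ... | tri< i<j _ _ = contradiction eq (proj₁ (ok i j i<j))
  ... | tri≈ _ i≡j _ = i≡j
  ... | tri> _ _ j<i = contradiction (sym eq) (proj₁ (ok j i j<i))

  edges : ∀ i j → adj G (f i) (f j) ≡ adj H i j
  edges i j with <-cmp i j
  ... | tri< i<j _ _  = proj₂ (ok i j i<j)
  ... | tri≈ _ refl _ = trans (irrefl G (f i)) (sym (irrefl H i))
  ... | tri> _ _ j<i  = trans (adj-sym G _ _) (trans (proj₂ (ok j i j<i)) (adj-sym H j i))

-- An Erdős-Szekeres recursion: besides one chosen vertex, enough others that either its neighbours
-- or its non-neighbours suffice for the induction.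
ramseyBound : ℕ → ℕ → ℕ
ramseyBound zero    _       = 0
ramseyBound (suc a) zero    = 0
ramseyBound (suc a) (suc b) = suc (ramseyBound a (suc b) + ramseyBound (suc a) b)

module _ {A : Set} where

  filter-pigeonhole : ∀ {P : A → Set} (P? : Decidable P) xs {a b} → a + b ≤ length xs →
    a ≤ length (filter P? xs) ⊎ b ≤ length (filter (¬? ∘ P?) xs)
  filter-pigeonhole P? []       {zero} _ = inj₁ z≤n
  filter-pigeonhole P? (x ∷ xs) {zero} _ = inj₁ z≤n
  filter-pigeonhole P? (x ∷ xs) {suc a} {zero} _ = inj₂ z≤n
  filter-pigeonhole P? (x ∷ xs) {suc a} {suc b} (s≤s le) with P? x
  ... | yes _ = [ inj₁ ∘ s≤s , inj₂ ]′ (filter-pigeonhole P? xs le)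
  ... | no _  = [ inj₁ , inj₂ ∘ s≤s ]′
    (filter-pigeonhole P? xs (≤-trans (≤-reflexive (sym (+-suc a b))) le))

  allPairs-lookup : ∀ {R : A → A → Set} → (∀ {x y} → R x y → R y x) → ∀ {xs} → AllPairs R xs →
    ∀ {x y} → x ∈ xs → y ∈ xs → x ≢ y → R x y
  allPairs-lookup R-sym (r ∷ rs) (here refl) (here refl) x≢y = contradiction refl x≢y
  allPairs-lookup R-sym (r ∷ rs) (here refl) (there y∈)  _   = All.lookup r y∈
  allPairs-lookup R-sym (r ∷ rs) (there x∈)  (here refl) _   = R-sym (All.lookup r x∈)
  allPairs-lookup R-sym (r ∷ rs) (there x∈)  (there y∈)  x≢y = allPairs-lookup R-sym rs x∈ y∈ x≢y

  allPairs-tabulate : ∀ {R : A → A → Set} {xs} → Unique xs →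
    (∀ {x y} → x ∈ xs → y ∈ xs → x ≢ y → R x y) → AllPairs R xs
  allPairs-tabulate []       f = []
  allPairs-tabulate (x≢ ∷ u) f =
    All.tabulate (λ y∈ → f (here refl) (there y∈) (All.lookup x≢ y∈)) ∷
    allPairs-tabulate u (λ x∈ y∈ → f (there x∈) (there y∈))

-- The structure of the graphs in the class

module Structure (G : Graph) (diamond-free : Free diamond G) (2P₁+P₃-free : Free 2P₁+P₃ G) where

  open Ordering G

  #-sym : ∀ {u v} → u # v → v # u
  #-sym {u} {v} (u≢v , e) = u≢v ∘ sym , trans (adj-sym G v u) e

  _#?_ : ∀ u v → Dec (u # v)
  u #? v = ¬? (u ≟ v) ×-dec (adj G u v ≟ᵇ false)

  #⇒≁ : ∀ {u v} → u # v → ¬ u ~ v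
  #⇒≁ (_ , e) e′ = contradiction (trans (sym e) e′) λ ()

  ≁⇒# : ∀ {u v} → u ≢ v → ¬ u ~ v → u # v
  ≁⇒# {u} {v} u≢v u≁v with rel u v
  ... | same eq = contradiction eq u≢v
  ... | near e  = contradiction e u≁v
  ... | far f   = f

  no-diamond : ∀ {a b c d} → a ~ b → a ~ c → a ~ d → b ~ c → b ~ d → ¬ c # d
  no-diamond {a} {b} {c} {d} ab ac ad bc bd (c≢d , cd) = diamond-free (mkInduced diamond G f ok)
    where
    f : Fin 4 → V
    f zero                   = a
    f (suc zero)             = b
    f (suc (suc zero))       = c
    f (suc (suc (suc zero))) = d

    edge′ : ∀ {u v} → u ~ v → u ≢ v × adj G u v ≡ true
    edge′ e = ~⇒≢ e , e

    ok : ∀ i j → i <ᶠ j → f i ≢ f j × adj G (f i) (f j) ≡ adj diamond i j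
    ok _ zero ()
    ok zero (suc zero) _ = edge′ ab
    ok (suc _) (suc zero) (s≤s ())
    ok zero (suc (suc zero)) _ = edge′ ac
    ok (suc zero) (suc (suc zero)) _ = edge′ bc
    ok (suc (suc _)) (suc (suc zero)) (s≤s (s≤s ()))
    ok zero (suc (suc (suc zero))) _ = edge′ ad
    ok (suc zero) (suc (suc (suc zero))) _ = edge′ bd
    ok (suc (suc zero)) (suc (suc (suc zero))) _ = c≢d , cd
    ok (suc (suc (suc _))) (suc (suc (suc zero))) (s≤s (s≤s (s≤s ())))

  no-2P₁+P₃ : ∀ {a b x y z} → x ~ y → y ~ z → x # z → a # b →
    a # x → a # y → a # z → b # x → b # y → ¬ b # z
  no-2P₁+P₃ {a} {b} {x} {y} {z} xy yz xz ab ax ay az bx by bz = 2P₁+P₃-free (mkInduced 2P₁+P₃ G f ok)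
    where
    f : Fin 5 → V
    f zero                         = a
    f (suc zero)                   = b
    f (suc (suc zero))             = x
    f (suc (suc (suc zero)))       = y
    f (suc (suc (suc (suc zero)))) = z

    ok : ∀ i j → i <ᶠ j → f i ≢ f j × adj G (f i) (f j) ≡ adj 2P₁+P₃ i j
    ok _ zero ()
    ok zero (suc zero) _ = ab
    ok (suc _) (suc zero) (s≤s ())
    ok zero (suc (suc zero)) _ = ax
    ok (suc zero) (suc (suc zero)) _ = bx
    ok (suc (suc _)) (suc (suc zero)) (s≤s (s≤s ()))
    ok zero (suc (suc (suc zero))) _ = ay
    ok (suc zero) (suc (suc (suc zero))) _ = by
    ok (suc (suc zero)) (suc (suc (suc zero))) _ = ~⇒≢ xy , xy
    ok (suc (suc (suc _))) (suc (suc (suc zero))) (s≤s (s≤s (s≤s ())))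
    ok zero (suc (suc (suc (suc zero)))) _ = az
    ok (suc zero) (suc (suc (suc (suc zero)))) _ = bz
    ok (suc (suc zero)) (suc (suc (suc (suc zero)))) _ = xz
    ok (suc (suc (suc zero))) (suc (suc (suc (suc zero)))) _ = ~⇒≢ yz , yz
    ok (suc (suc (suc (suc _)))) (suc (suc (suc (suc zero)))) (s≤s (s≤s (s≤s (s≤s ()))))

  -- Ramsey's theorem and single exceptions

  Homogeneous : (V → V → Set) → ℕ → List V → Set
  Homogeneous R k xs = ∃ λ ys → length ys ≡ k × (∀ {y} → y ∈ ys → y ∈ xs) × AllPairs R ys

  ramsey : ∀ a b {xs} → Unique xs → ramseyBound a b ≤ length xs →
    Homogeneous _~_ a xs ⊎ Homogeneous _#_ b xs
  ramsey zero    _    _ _ = inj₁ ([] , refl , (λ ()) , [])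
  ramsey (suc a) zero _ _ = inj₂ ([] , refl , (λ ()) , [])
  ramsey (suc a) (suc b) {x ∷ xs} (x≢ ∷ u) (s≤s le) with filter-pigeonhole (x ~?_) xs le
  ... | inj₁ many with ramsey a (suc b) (filter⁺ (x ~?_) u) many
  ...   | inj₁ (ys , eq , sub , pairs) = inj₁ (x ∷ ys , cong suc eq ,
      (λ { (here refl) → here refl ; (there y∈) → there (proj₁ (∈-filter⁻ (x ~?_) (sub y∈))) }) ,
      All.tabulate (λ y∈ → proj₂ (∈-filter⁻ (x ~?_) {xs = xs} (sub y∈))) ∷ pairs)
  ...   | inj₂ (ys , eq , sub , pairs) = inj₂ (ys , eq ,
      (λ y∈ → there (proj₁ (∈-filter⁻ (x ~?_) (sub y∈)))) , pairs)
  ramsey (suc a) (suc b) {x ∷ xs} (x≢ ∷ u) (s≤s le) | inj₂ many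
    with ramsey (suc a) b (filter⁺ (¬? ∘ (x ~?_)) u) many
  ... | inj₁ (ys , eq , sub , pairs) = inj₁ (ys , eq ,
      (λ y∈ → there (proj₁ (∈-filter⁻ (¬? ∘ (x ~?_)) (sub y∈)))) , pairs)
  ... | inj₂ (ys , eq , sub , pairs) = inj₂ (x ∷ ys , cong suc eq ,
      (λ { (here refl) → here refl ; (there y∈) → there (proj₁ (∈-filter⁻ (¬? ∘ (x ~?_)) (sub y∈))) }) ,
      All.tabulate (λ y∈ → let y∈xs , x≁y = ∈-filter⁻ (¬? ∘ (x ~?_)) {xs = xs} (sub y∈)
                           in ≁⇒# (All.lookup x≢ y∈xs) x≁y) ∷ pairs)

  fresh : ∀ {xs} → Unique xs → ∀ ps → length ps < length xs → ∃ λ x → x ∈ xs × x ∉ ps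
  fresh {xs} u ps lt with Any.any? (λ x → ¬? (x ∈? ps)) xs
  ... | yes p = find p
  ... | no ¬p = contradiction (unique-⊆⇒length≤ u xs⊆ps) (<⇒≱ lt)
    where
    xs⊆ps : ∀ {x} → x ∈ xs → x ∈ ps
    xs⊆ps {x} x∈ with x ∈? ps
    ... | yes x∈ps = x∈ps
    ... | no x∉ps  = contradiction (Any.map (λ { refl → x∉ps }) x∈) ¬p

  -- Turns "at most one vertex" into a named vertex that can be excluded or deleted; `v₀` is an
  -- arbitrary value for the case of none.
  unique-witness : ∀ {Q : V → Set} → Decidable Q → (∀ {x y} → Q x → Q y → x ≡ y) → V →
    ∃ λ p → ∀ {x} → Q x → x ≡ p
  unique-witness Q? uniq v₀ with any? Q?
  ... | yes (p , q) = p , λ q′ → uniq q′ q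
  ... | no ¬∃       = v₀ , λ q → contradiction (_ , q) ¬∃

  -- As `#` excludes equality, `p` stands for the only neighbour of `v` in `C` or for `v` itself;
  -- thus the members of an independent set `C` qualify too.
  Few : (V → Set) → V → Set
  Few C v = ∃ λ p → ∀ {i} → C i → i ≢ p → v # i

  few : ∀ {C v} → Decidable C → (∀ {i j} → C i → C j → ¬ v # i → ¬ v # j → i ≡ j) → Few C v
  few {C} {v} C? uniq with unique-witness (λ i → C? i ×-dec ¬? (v #? i))
                             (λ (ci , ti) (cj , tj) → uniq ci cj ti tj) v
  ... | p , only = p , far′
    where
    far′ : ∀ {i} → C i → i ≢ p → v # i
    far′ {i} ci i≢p with v #? i
    ... | yes f = f
    ... | no t  = contradiction (only (ci , t)) i≢p

  few-nbr : ∀ {C v i} ((p , _) : Few C v) → C i → v ~ i → i ≡ p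
  few-nbr {i = i} (p , far′) ci vi with i ≟ p
  ... | yes eq = eq
  ... | no ≢   = contradiction vi (#⇒≁ (far′ ci ≢))

  -- Vertices seen from a large independent set

  module LargeIndependent (I : List V) (pairs : AllPairs _#_ I) (five : 5 ≤ length I) where

    independent : ∀ {i j} → i ∈ I → j ∈ I → i ≢ j → i # j
    independent = allPairs-lookup #-sym pairs

    unique : Unique I
    unique = AllPairs.map proj₁ pairs

    Big : V → Set
    Big v = ∃₂ λ i j → i ∈ I × j ∈ I × i ≢ j × v ~ i × v ~ j

    big? : Decidable Big
    big? v = any? λ i → any? λ j → (i ∈? I) ×-dec (j ∈? I) ×-dec ¬? (i ≟ j) ×-dec (v ~? i) ×-dec (v ~? j)

    big∉ : ∀ {v} → Big v → v ∉ I
    big∉ (i , _ , i∈ , _ , _ , vi , _) v∈ = #⇒≁ (independent v∈ i∈ (~⇒≢ vi)) vi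

    small⇒few : ∀ {v} → ¬ Big v → Few (_∈ I) v
    small⇒few {v} ¬big = few (_∈? I) uniq
      where
      uniq : ∀ {i j} → i ∈ I → j ∈ I → ¬ v # i → ¬ v # j → i ≡ j
      uniq {i} {j} i∈ j∈ ti tj with i ≟ j | rel v i | rel v j
      ... | yes eq | _         | _         = eq
      ... | no _   | far f     | _         = contradiction f ti
      ... | no _   | _         | far f     = contradiction f tj
      ... | no i≢j | same refl | _         = contradiction (independent i∈ j∈ i≢j) tj
      ... | no i≢j | near _    | same refl = contradiction (independent j∈ i∈ (i≢j ∘ sym)) ti
      ... | no i≢j | near vi   | near vj   = contradiction (i , j , i∈ , j∈ , i≢j , vi , vj) ¬big

    -- Two missed vertices of I and a P₃ centred at v with ends in I would form 2P₁+P₃.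
    big-misses-one : ∀ {v} → Big v → ∀ {k l} → k ∈ I → l ∈ I → ¬ v ~ k → ¬ v ~ l → k ≡ l
    big-misses-one {v} big@(i , j , i∈ , j∈ , i≢j , vi , vj) {k} {l} k∈ l∈ ¬vk ¬vl with k ≟ l
    ... | yes eq = eq
    ... | no k≢l = ⊥-elim (no-2P₁+P₃ (~-sym vi) vj (independent i∈ j∈ i≢j) (independent k∈ l∈ k≢l)
          (indep vi ¬vk k∈ i∈) (miss ¬vk k∈) (indep vj ¬vk k∈ j∈)
          (indep vi ¬vl l∈ i∈) (miss ¬vl l∈) (indep vj ¬vl l∈ j∈))
      where
      indep : ∀ {a b} → v ~ a → ¬ v ~ b → b ∈ I → a ∈ I → b # a
      indep va ¬vb b∈ a∈ = independent b∈ a∈ (λ { refl → ¬vb va })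

      miss : ∀ {b} → ¬ v ~ b → b ∈ I → b # v
      miss ¬vb b∈ = #-sym (≁⇒# (λ { refl → big∉ big b∈ }) ¬vb)

    big⇒most : ∀ {v} → Big v → ∃ λ q → ∀ {i} → i ∈ I → i ≢ q → v ~ i
    big⇒most {v} big with unique-witness (λ i → (i ∈? I) ×-dec ¬? (v ~? i))
                           (λ (k∈ , ¬k) (l∈ , ¬l) → big-misses-one big k∈ l∈ ¬k ¬l) v
    ... | q , only = q , most
      where
      most : ∀ {i} → i ∈ I → i ≢ q → v ~ i
      most {i} i∈ i≢q with v ~? i
      ... | yes e = e
      ... | no ¬e = contradiction (only (i∈ , ¬e)) i≢q

    -- The second choice has to avoid four vertices, which is why `I` needs five.
    two-fresh : ∀ p q r → ∃₂ λ i j → i ∈ I × j ∈ I × i # j ×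
      (i ≢ p × i ≢ q × i ≢ r) × (j ≢ p × j ≢ q × j ≢ r)
    two-fresh p q r with fresh unique (p ∷ q ∷ r ∷ []) (<⇒≤ five)
    ... | i , i∈ , i∉ with fresh unique (i ∷ p ∷ q ∷ r ∷ []) five
    ...   | j , j∈ , j∉ = i , j , i∈ , j∈ , independent i∈ j∈ (λ { refl → j∉ (here refl) }) ,
        (i∉ ∘ here , i∉ ∘ there ∘ here , i∉ ∘ there ∘ there ∘ here) ,
        (j∉ ∘ there ∘ here , j∉ ∘ there ∘ there ∘ here , j∉ ∘ there ∘ there ∘ there ∘ here)

    -- Two vertices of `I` away from the three exceptions would complete an induced P₃ to 2P₁+P₃.
    few-cluster : Cluster (Few (_∈ I))
    few-cluster (p , fp) (q , fq) (r , fr) xy yz xz with two-fresh p q r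
    ... | i , j , i∈ , j∈ , ij , (ip , iq , ir) , (jp , jq , jr) = no-2P₁+P₃ xy yz xz ij
      (#-sym (fp i∈ ip)) (#-sym (fq i∈ iq)) (#-sym (fr i∈ ir))
      (#-sym (fp j∈ jp)) (#-sym (fq j∈ jq)) (#-sym (fr j∈ jr))

    -- Two adjacent big vertices would have two nonadjacent common neighbours in `I`: a diamond.
    big-independent : ∀ {u v} → Big u → Big v → u ≢ v → u # v
    big-independent {u} {v} bu bv u≢v with rel u v | big⇒most bu | big⇒most bv
    ... | same eq | _ | _ = contradiction eq u≢v
    ... | far f   | _ | _ = f
    ... | near uv | p , mp | q , mq with two-fresh p q q
    ...   | i , j , i∈ , j∈ , ij , (ip , iq , _) , (jp , jq , _) =
      contradiction ij (no-diamond uv (mp i∈ ip) (mp j∈ jp) (mq i∈ iq) (mq j∈ jq))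

  -- Bounds every deleted set: it has at most 4 vertices, or is too small for Ramsey's theorem.
  constant : ℕ
  constant = 4 + ramseyBound 5 5

  Bounded : Set
  Bounded = CWAtMost (2 * (constant + 12)) G

  cw-mono : ∀ {c d} → c ≤ d → CWAtMost c G → CWAtMost d G
  cw-mono c≤d (inj₁ eq)           = inj₁ eq
  cw-mono c≤d (inj₂ (k , k≤c , e)) = inj₂ (k , ≤-trans k≤c c≤d , e)

  cluster⇒bounded : ∀ S → length S ≤ constant → Cluster (_∉ S) → Bounded
  cluster⇒bounded S le cl = cw-mono (*-monoʳ-≤ 2 (+-mono-≤ le (m≤m+n 2 10))) (cluster⇒cw S cl)

  -- The classes come from a view, so that the degree condition can be proved by matching on the
  -- kinds of both vertices.
  flip⇒bounded : ∀ S → length S ≤ 4 → {Kind : V → Set} (view : ∀ v → Kind v)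
    (code : ∀ {v} → Kind v → Fin 3) (φ : Fin 3 → Fin 3 → Bool) → (∀ i j → φ i j ≡ φ j i) → V →
    (∀ {v} → v ∉ S → (k : Kind v) → ∃₂ λ a b → ∀ {w} → w ∉ S → v ≢ w → (l : Kind w) →
       adj G v w ≢ φ (code k) (code l) → w ≡ a ⊎ w ≡ b) → Bounded
  flip⇒bounded S le view code φ φ-sym v₀ deg =
    cw-mono (*-monoʳ-≤ 2 (+-monoˡ-≤ 12 (≤-trans le (m≤m+n 4 (ramseyBound 5 5)))))
      (flip⇒cw S (λ v → code (view v)) φ φ-sym v₀ λ {v} v∉ →
        let a , b , h = deg v∉ (view v) in a , b , λ {w} w∉ (v≢w , ex) → h w∉ v≢w (view w) ex)

  few≤ : ∀ {m} → ¬ 5 ≤ m → m ≤ constant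
  few≤ ¬5≤ = ≤-trans (≤-pred (≰⇒> ¬5≤)) (m≤m+n 4 (ramseyBound 5 5))

  -- Graphs with five independent vertices

  module ManyIndependent (I : List V) (pairs : AllPairs _#_ I) (five : 5 ≤ length I) where

    module I = LargeIndependent I pairs five

    B : List V
    B = filter I.big? (allFin (n G))

    ∈B : ∀ {v} → I.Big v → v ∈ B
    ∈B big = ∈-filter⁺ I.big? (∈-allFin _) big

    B⁻ : ∀ {v} → v ∈ B → I.Big v
    B⁻ v∈ = proj₂ (∈-filter⁻ I.big? {xs = allFin (n G)} v∈)

    module ManyBig (fiveB : 5 ≤ length B) where

      module J = LargeIndependent B
        (allPairs-tabulate (filter⁺ I.big? (allFin⁺ (n G)))
          (λ u∈ v∈ → I.big-independent (B⁻ u∈) (B⁻ v∈))) fiveB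

      X Y Z : V → Set
      X v = I.Big v
      Y v = J.Big v × ¬ I.Big v
      Z v = ¬ I.Big v × ¬ J.Big v

      data Kind (v : V) : Set where
        isX : X v → Kind v
        isY : Y v → Kind v
        isZ : Z v → Kind v

      view : ∀ v → Kind v
      view v with I.big? v | J.big? v
      ... | yes x | _     = isX x
      ... | no ¬x | yes y = isY (y , ¬x)
      ... | no ¬x | no ¬y = isZ (¬x , ¬y)

      Y? : Decidable Y
      Y? v = J.big? v ×-dec ¬? (I.big? v)

      Z? : Decidable Z
      Z? v = ¬? (I.big? v) ×-dec ¬? (J.big? v)

      code : ∀ {v} → Kind v → Fin 3
      code (isX _) = zero
      code (isY _) = suc zero
      code (isZ _) = suc (suc zero)

      φ : Fin 3 → Fin 3 → Bool
      φ zero             (suc zero)       = true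
      φ (suc zero)       zero             = true
      φ (suc (suc zero)) (suc (suc zero)) = true
      φ _                _                = false

      φ-sym : ∀ i j → φ i j ≡ φ j i
      φ-sym zero             zero             = refl
      φ-sym zero             (suc zero)       = refl
      φ-sym zero             (suc (suc zero)) = refl
      φ-sym (suc zero)       zero             = refl
      φ-sym (suc zero)       (suc zero)       = refl
      φ-sym (suc zero)       (suc (suc zero)) = refl
      φ-sym (suc (suc zero)) zero             = refl
      φ-sym (suc (suc zero)) (suc zero)       = refl
      φ-sym (suc (suc zero)) (suc (suc zero)) = refl

      -- Otherwise some `b` in `B` is nonadjacent to `u` and `v`, and with two of its neighbours in
      -- `I` away from both it forms a P₃ that `u` and `v` complete to 2P₁+P₃.
      z-clique : ∀ {u v} → Z u → Z v → u ≢ v → u ~ v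
      z-clique {u} {v} (¬xu , ¬yu) (¬xv , ¬yv) u≢v with rel u v
      ... | same eq = contradiction eq u≢v
      ... | near uv = uv
      ... | far uv with J.small⇒few ¬yu | J.small⇒few ¬yv | I.small⇒few ¬xu | I.small⇒few ¬xv
      ...   | bu , fbu | bv , fbv | p , fp | q , fq
          with fresh J.unique (bu ∷ bv ∷ []) (≤-trans (s≤s (s≤s (s≤s z≤n))) fiveB)
      ...     | b , b∈ , b∉ with I.big⇒most (B⁻ b∈)
      ...       | r , mr with I.two-fresh p q r
      ...         | i , j , i∈ , j∈ , ij , (ip , iq , ir) , (jp , jq , jr) =
        ⊥-elim (no-2P₁+P₃ (~-sym (mr i∈ ir)) (mr j∈ jr) ij uv
          (fp i∈ ip) (fbu b∈ (b∉ ∘ here)) (fp j∈ jp)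
          (fq i∈ iq) (fbv b∈ (b∉ ∘ there ∘ here)) (fq j∈ jq))

      -- Two missed vertices `y`, `y′` are nonadjacent and complete a P₃ centred at `x`, with ends
      -- in `I` away from both, to 2P₁+P₃.
      x-misses-one : ∀ {x y y′} → X x → Y y → Y y′ → ¬ x ~ y → ¬ x ~ y′ → y ≡ y′
      x-misses-one {x} {y} {y′} X-x (Jy , ¬Iy) (Jy′ , ¬Iy′) ¬xy ¬xy′ with y ≟ y′
      ... | yes eq = eq
      ... | no y≢y′ with I.small⇒few ¬Iy | I.small⇒few ¬Iy′ | I.big⇒most X-x
      ...   | p , fp | q , fq | r , mr with I.two-fresh p q r
      ...     | i , j , i∈ , j∈ , ij , (ip , iq , ir) , (jp , jq , jr) =
        ⊥-elim (no-2P₁+P₃ (~-sym (mr i∈ ir)) (mr j∈ jr) ij (J.big-independent Jy Jy′ y≢y′)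
          (fp i∈ ip) (#-sym (≁⇒# (λ { refl → ¬Iy X-x }) ¬xy)) (fp j∈ jp)
          (fq i∈ iq) (#-sym (≁⇒# (λ { refl → ¬Iy′ X-x }) ¬xy′)) (fq j∈ jq))

      Touching : (V → Set) → V → Set
      Touching C v = C v × ∃ λ z → Z z × z ~ v

      touching? : ∀ {C} → Decidable C → Decidable (Touching C)
      touching? C? v = C? v ×-dec any? (λ z → Z? z ×-dec (z ~? v))

      -- If `u` and `v` both touch the clique `Z`, then `u`, a vertex of `Z` and either `v` or a
      -- second vertex of `Z` form an induced P₃ inside the cluster `W`.
      touching-unique : ∀ {W C : V → Set} → Cluster W → (∀ {v} → C v → W v) → (∀ {v} → Z v → W v) →
        (∀ {u v} → C u → C v → u ≢ v → u # v) →
        ∀ {u v} → Touching C u → Touching C v → u ≡ v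
      touching-unique clW C⊆W Z⊆W indep {u} {v} (cu , z , Zz , zu) (cv , z′ , Zz′ , z′v)
        with u ≟ v | z ≟ z′ | rel u z′
      ... | yes eq | _ | _ = eq
      ... | no u≢v | yes refl | _ =
        ⊥-elim (clW (C⊆W cu) (Z⊆W Zz) (C⊆W cv) (~-sym zu) z′v (indep cu cv u≢v))
      ... | no u≢v | no _ | same refl = contradiction z′v (#⇒≁ (indep cu cv u≢v))
      ... | no u≢v | no _ | near uz′ =
        ⊥-elim (clW (C⊆W cu) (Z⊆W Zz′) (C⊆W cv) uz′ z′v (indep cu cv u≢v))
      ... | no u≢v | no z≢z′ | far uz′ =
        ⊥-elim (clW (C⊆W cu) (Z⊆W Zz) (Z⊆W Zz′) (~-sym zu) (z-clique Zz Zz′ z≢z′) uz′)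

      v₀ : V
      v₀ = proj₁ (fresh J.unique [] (≤-trans (s≤s z≤n) fiveB))

      bounded : Bounded
      bounded
        -- The cluster is that of the opposite independent set: vertices of `X` have few neighbours
        -- in `B`, those of `Y` few in `I`, and those of `Z` few in both.
        with unique-witness (touching? I.big?)
               (touching-unique J.few-cluster (λ x → J.small⇒few (λ y → J.big∉ y (∈B x)))
                  (J.small⇒few ∘ proj₂) I.big-independent) v₀
           | unique-witness (touching? Y?)
               (touching-unique I.few-cluster (I.small⇒few ∘ proj₂) (I.small⇒few ∘ proj₁)
                  (λ (y , _) (y′ , _) → J.big-independent y y′)) v₀
      ... | x₀ , only-x | y₀ , only-y =
        flip⇒bounded S (s≤s (s≤s z≤n)) view code φ φ-sym v₀ deg
        where
        S : List V
        S = x₀ ∷ y₀ ∷ []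

        nonadjacent : ∀ {u v} → ¬ u ~ v → adj G u v ≡ false
        nonadjacent {u} {v} ¬uv with adj G u v
        ... | true  = contradiction refl ¬uv
        ... | false = refl

        x∉S : ∀ {x z} → X x → Z z → x ∉ S → ¬ z ~ x
        x∉S Xx Zz x∉ zx = x∉ (here (only-x (Xx , _ , Zz , zx)))

        y∉S : ∀ {y z} → Y y → Z z → y ∉ S → ¬ z ~ y
        y∉S Yy Zz y∉ zy = y∉ (there (here (only-y (Yy , _ , Zz , zy))))

        deg : ∀ {v} → v ∉ S → (k : Kind v) → ∃₂ λ a b → ∀ {w} → w ∉ S → v ≢ w → (l : Kind w) →
              adj G v w ≢ φ (code k) (code l) → w ≡ a ⊎ w ≡ b
        deg {v} v∉ (isX x) with unique-witness (λ w → Y? w ×-dec ¬? (v ~? w))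
                                  (λ (y , m) (y′ , m′) → x-misses-one x y y′ m m′) v₀
        ... | a , only = a , a , λ
          { _ v≢w (isX x′) ex → contradiction (proj₂ (I.big-independent x x′ v≢w)) ex
          ; _ _ (isY y) ex → inj₁ (only (y , ex))
          ; _ _ (isZ z) ex → contradiction (nonadjacent (x∉S x z v∉ ∘ ~-sym)) ex }
        deg {v} v∉ (isY y) with unique-witness (λ w → I.big? w ×-dec ¬? (v ~? w))
                                  (λ (x , m) (x′ , m′) → J.big-misses-one (proj₁ y) (∈B x) (∈B x′) m m′) v₀
        ... | a , only = a , a , λ
          { _ _ (isX x) ex → inj₁ (only (x , ex))
          ; _ v≢w (isY y′) ex → contradiction (proj₂ (J.big-independent (proj₁ y) (proj₁ y′) v≢w)) ex
          ; _ _ (isZ z) ex → contradiction (nonadjacent (y∉S y z v∉ ∘ ~-sym)) ex }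
        deg {v} v∉ (isZ z) = v₀ , v₀ , λ
          { w∉ _ (isX x) ex → contradiction (nonadjacent (x∉S x z w∉)) ex
          ; w∉ _ (isY y) ex → contradiction (nonadjacent (y∉S y z w∉)) ex
          ; _ v≢w (isZ z′) ex → contradiction (z-clique z z′ v≢w) ex }

    bounded : Bounded
    bounded with 5 ≤? length B
    ... | yes fiveB = ManyBig.bounded fiveB
    ... | no ¬fiveB = cluster⇒bounded B (few≤ ¬fiveB)
      λ x∉ y∉ z∉ → I.few-cluster (small x∉) (small y∉) (small z∉)
      where
      small : ∀ {v} → v ∉ B → Few (_∈ I) v
      small v∉ = I.small⇒few (v∉ ∘ ∈B)

  independent⇒bounded : ∀ {xs} → Homogeneous _#_ 5 xs → Bounded
  independent⇒bounded (I , eq , _ , pairs) =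
    ManyIndependent.bounded I pairs (≤-reflexive (sym eq))

  -- Maximal cliques in diamond-free graphs

  IsClique : (V → Set) → Set
  IsClique C = ∀ {u v} → C u → C v → u ≢ v → u ~ v

  AtMostOneNbr : (V → Set) → V → Set
  AtMostOneNbr C v = ∀ {k l} → C k → C l → v ~ k → v ~ l → k ≡ l

  few⇒one-nbr : ∀ {C v} → Few C v → AtMostOneNbr C v
  few⇒one-nbr f Ck Cl vk vl = trans (few-nbr f Ck vk) (sym (few-nbr f Cl vl))

  -- Two neighbours of `v` in the clique would be adjacent common neighbours of the nonadjacent `v`
  -- and `c`: a diamond.
  far⇒one-nbr : ∀ {C v c} → IsClique C → C c → v # c → AtMostOneNbr C v
  far⇒one-nbr {v = v} {c} clique Cc vc {k} {l} Ck Cl vk vl with k ≟ l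
  ... | yes eq = eq
  ... | no k≢l = ⊥-elim (no-diamond (clique Ck Cl k≢l) (~-sym vk) (clique Ck Cc (≢c vk))
                           (~-sym vl) (clique Cl Cc (≢c vl)) vc)
    where
    ≢c : ∀ {x} → v ~ x → x ≢ c
    ≢c vx refl = #⇒≁ vc vx

  -- Only the neighbour p of one fixed vertex of the clique can be complete to it.
  one-nbr-reverse : ∀ {C D} → IsClique C → Decidable C → Decidable D →
    (∀ {v} → D v → ¬ C v) → (∀ {c} → C c → AtMostOneNbr D c) → V →
    ∃ λ p → ∀ {d} → D d → d ≢ p → AtMostOneNbr C d
  one-nbr-reverse clique C? D? disjoint one v₀ with any? C?
  ... | no ¬∃ = v₀ , λ _ _ Ck → contradiction (_ , Ck) ¬∃
  ... | yes (c , Cc) with unique-witness (λ d → D? d ×-dec (c ~? d))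
                            (λ (Dd , cd) (De , ce) → one Cc Dd De cd ce) v₀
  ...   | p , only = p , λ Dd d≢p → far⇒one-nbr clique Cc
      (≁⇒# (λ { refl → disjoint Dd Cc }) (λ dc → d≢p (only (Dd , ~-sym dc))))

  -- Maximality within `P` enters through its consequence `outside`. The list `core` of at least
  -- five members allows `pick` to avoid any four vertices.
  record MaximalClique (P : V → Set) : Set₁ where
    field
      K       : V → Set
      K?      : Decidable K
      K⊆P     : ∀ {v} → K v → P v
      clique  : IsClique K
      outside : ∀ {v} → P v → ¬ K v → Few K v
      core    : List V
      core⊆K  : ∀ {v} → v ∈ core → K v
      unique  : Unique core
      five    : 5 ≤ length core

    pick : ∀ ps → length ps ≤ 4 → ∃ λ k → K k × k ∉ ps
    pick ps le with fresh unique ps (≤-trans (s≤s le) five)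
    ... | k , k∈ , k∉ = k , core⊆K k∈ , k∉

  -- In a diamond-free graph an edge x y lies in exactly one maximal clique, namely
  -- x, y and their common neighbours.
  maximalClique : ∀ {P xs} → Decidable P → (∀ {v} → v ∈ xs → P v) →
    Homogeneous _~_ 5 xs → MaximalClique P
  maximalClique {P} P? xs⊆P (core@(x ∷ y ∷ ws) , eq , core⊆xs , pairs@((xy ∷ _) ∷ _)) = record
    { K = K
    ; K? = λ v → P? v ×-dec (x ≈? v) ×-dec (y ≈? v)
    ; K⊆P = proj₁
    ; clique = clique
    ; outside = outside
    ; core = core
    ; core⊆K = λ v∈ → xs⊆P (core⊆xs v∈) , in-core (here refl) v∈ , in-core (there (here refl)) v∈
    ; unique = AllPairs.map ~⇒≢ pairs
    ; five = ≤-reflexive (sym eq) }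
    where
    _≈_ : V → V → Set
    u ≈ v = u ≡ v ⊎ u ~ v

    _≈?_ : ∀ u v → Dec (u ≈ v)
    u ≈? v = (u ≟ v) ⊎-dec (u ~? v)

    K : V → Set
    K v = P v × x ≈ v × y ≈ v

    in-core : ∀ {u v} → u ∈ core → v ∈ core → u ≈ v
    in-core {u} {v} u∈ v∈ with u ≟ v
    ... | yes eq′ = inj₁ eq′
    ... | no u≢v  = inj₂ (allPairs-lookup ~-sym pairs u∈ v∈ u≢v)

    ≈⇒~ : ∀ {u v} → u ≈ v → u ≢ v → u ~ v
    ≈⇒~ (inj₁ eq′) u≢v = contradiction eq′ u≢v
    ≈⇒~ (inj₂ e)   _   = e

    clique : IsClique K
    clique (_ , inj₁ refl , _) (_ , xv , _) u≢v = ≈⇒~ xv u≢v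
    clique (_ , xu , _) (_ , inj₁ refl , _) u≢v = ~-sym (≈⇒~ xu (u≢v ∘ sym))
    clique (_ , _ , inj₁ refl) (_ , _ , yv) u≢v = ≈⇒~ yv u≢v
    clique (_ , _ , yu) (_ , _ , inj₁ refl) u≢v = ~-sym (≈⇒~ yu (u≢v ∘ sym))
    clique {u} {v} (_ , inj₂ xu , inj₂ yu) (_ , inj₂ xv , inj₂ yv) u≢v with rel u v
    ... | same eq′ = contradiction eq′ u≢v
    ... | near uv  = uv
    ... | far uv   = ⊥-elim (no-diamond xy xu xv yu yv uv)

    two-nbrs : ∀ {v k l c} → K k → K l → k ≢ l → v ~ k → v ~ l → K c → c ≈ v
    two-nbrs {v} {k} {l} {c} Kk Kl k≢l vk vl Kc with rel c v
    ... | same eq′ = inj₁ eq′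
    ... | near cv  = inj₂ cv
    ... | far cv   = contradiction (far⇒one-nbr clique Kc (#-sym cv) Kk Kl vk vl) k≢l

    outside : ∀ {v} → P v → ¬ K v → Few K v
    outside {v} Pv ¬Kv = few (λ w → P? w ×-dec (x ≈? w) ×-dec (y ≈? w)) uniq
      where
      K-core : ∀ {c} → c ∈ core → K c
      K-core c∈ = xs⊆P (core⊆xs c∈) , in-core (here refl) c∈ , in-core (there (here refl)) c∈

      touch⇒~ : ∀ {i} → K i → ¬ v # i → v ~ i
      touch⇒~ {i} Ki t with rel v i
      ... | same refl = contradiction Ki ¬Kv
      ... | near e    = e
      ... | far f     = contradiction f t

      uniq : ∀ {i j} → K i → K j → ¬ v # i → ¬ v # j → i ≡ j
      uniq {i} {j} Ki Kj ti tj with i ≟ j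
      ... | yes eq′ = eq′
      -- Two neighbours in `K` make `v` equal or adjacent to all of `K`, in particular to `x` and
      -- `y`, so `v` would belong to `K`.
      ... | no i≢j  = contradiction (Pv , nbr (K-core (here refl)) , nbr (K-core (there (here refl)))) ¬Kv
        where
        nbr : ∀ {c} → K c → c ≈ v
        nbr = two-nbrs Ki Kj i≢j (touch⇒~ Ki ti) (touch⇒~ Kj tj)

  -- Two disjoint maximal cliques and the remainder

  module TwoCliques (MK : MaximalClique (λ _ → ⊤))
                    (ML : MaximalClique (λ v → ¬ MaximalClique.K MK v)) where

    module K = MaximalClique MK
    module L = MaximalClique ML
    open K using (K; K?)
    open L using () renaming (K to L; K? to L?)

    M : V → Set
    M v = ¬ K v × ¬ L v

    M? : Decidable M
    M? v = ¬? (K? v) ×-dec ¬? (L? v)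

    L∌K : ∀ {v} → L v → ¬ K v
    L∌K = L.K⊆P

    few-K : ∀ {v} → ¬ K v → Few K v
    few-K = K.outside tt

    few-L : ∀ {v} → M v → Few L v
    few-L (¬k , ¬l) = L.outside ¬k ¬l

    v₀ : V
    v₀ = proj₁ (K.pick [] z≤n)

    -- An induced P₃ in `M` would be completed to 2P₁+P₃ by some `l` in `L` and `k` in `K`. The
    -- choice of `l` comes first: `l` has at most one neighbour in `K`, while `k` may have many in
    -- `L`.
    m-cluster : Cluster M
    m-cluster Mx My Mz xy yz xz with few-L Mx | few-L My | few-L Mz
    ... | p , fp | q , fq | r , fr with L.pick (p ∷ q ∷ r ∷ []) (s≤s (s≤s (s≤s z≤n)))
    ...   | l , Ll , l∉ with few-K (proj₁ Mx) | few-K (proj₁ My) | few-K (proj₁ Mz) | few-K (L∌K Ll)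
    ...     | p′ , fp′ | q′ , fq′ | r′ , fr′ | s′ , fs′
            with K.pick (p′ ∷ q′ ∷ r′ ∷ s′ ∷ []) ≤-refl
    ...       | k , Kk , k∉ = no-2P₁+P₃ xy yz xz (#-sym (fs′ Kk (k∉ ∘ there ∘ there ∘ there ∘ here)))
      (#-sym (fp′ Kk (k∉ ∘ here))) (#-sym (fq′ Kk (k∉ ∘ there ∘ here)))
      (#-sym (fr′ Kk (k∉ ∘ there ∘ there ∘ here)))
      (#-sym (fp Ll (l∉ ∘ here))) (#-sym (fq Ll (l∉ ∘ there ∘ here)))
      (#-sym (fr Ll (l∉ ∘ there ∘ there ∘ here)))

    data Kind (v : V) : Set where
      isK : K v → Kind v
      isL : L v → Kind v
      isM : M v → Kind v

    view : ∀ v → Kind v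
    view v with K? v | L? v
    ... | yes k | _     = isK k
    ... | no ¬k | yes l = isL l
    ... | no ¬k | no ¬l = isM (¬k , ¬l)

    module ThreeCliques (m-clique : IsClique M) where

      code : ∀ {v} → Kind v → Fin 3
      code (isK _) = zero
      code (isL _) = suc zero
      code (isM _) = suc (suc zero)

      φ : Fin 3 → Fin 3 → Bool
      φ i j = does (i ≟ j)

      φ-sym : ∀ i j → φ i j ≡ φ j i
      φ-sym i j with i ≟ j | j ≟ i
      ... | yes _    | yes _    = refl
      ... | yes refl | no ≢     = contradiction refl ≢
      ... | no ≢     | yes refl = contradiction refl ≢
      ... | no _     | no _     = refl

      nonfalse : ∀ {u v} → adj G u v ≢ false → u ~ v
      nonfalse {u} {v} ex with adj G u v
      ... | true  = refl
      ... | false = contradiction refl ex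

      sole-nbr : ∀ {C v} → Decidable C → AtMostOneNbr C v →
        ∃ λ p → ∀ {w} → C w → adj G v w ≢ false → w ≡ p
      sole-nbr {v = v} C? one
        with unique-witness (λ w → C? w ×-dec (v ~? w)) (λ (ck , vk) (cl , vl) → one ck cl vk vl) v
      ... | p , only = p , λ cw ex → only (cw , nonfalse ex)

      bounded : Bounded
      bounded
        -- After deletion of `p`, `q` and `r`, each vertex has at most one neighbour in each of the
        -- other two cliques: `p` and `q` serve `K` towards `L` and `M`, and `r` serves `L` towards
        -- `M`. `few-K` and `few-L` give the opposite directions.
        with one-nbr-reverse L.clique L? K? (λ k l → L∌K l k) (λ l → few⇒one-nbr (few-K (L∌K l))) v₀
           | one-nbr-reverse m-clique M? K? (λ k m → proj₁ m k) (λ m → few⇒one-nbr (few-K (proj₁ m))) v₀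
           | one-nbr-reverse m-clique M? L? (λ l m → proj₂ m l) (λ m → few⇒one-nbr (few-L m)) v₀
      ... | p , kl | q , km | r , lm = flip⇒bounded S (s≤s (s≤s (s≤s z≤n))) view code φ φ-sym v₀ deg
        where
        S : List V
        S = p ∷ q ∷ r ∷ []

        deg : ∀ {v} → v ∉ S → (k : Kind v) → ∃₂ λ a b → ∀ {w} → w ∉ S → v ≢ w → (l : Kind w) →
              adj G v w ≢ φ (code k) (code l) → w ≡ a ⊎ w ≡ b
        deg v∉ (isK k) with sole-nbr L? (kl k (v∉ ∘ here)) | sole-nbr M? (km k (v∉ ∘ there ∘ here))
        ... | a , a-only | b , b-only = a , b , λ
          { _ v≢w (isK k′) ex → contradiction (K.clique k k′ v≢w) ex
          ; _ _ (isL l) ex → inj₁ (a-only l ex)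
          ; _ _ (isM m) ex → inj₂ (b-only m ex) }
        deg v∉ (isL l) with sole-nbr K? (few⇒one-nbr (few-K (L∌K l))) | sole-nbr M? (lm l (v∉ ∘ there ∘ there ∘ here))
        ... | a , a-only | b , b-only = a , b , λ
          { _ _ (isK k) ex → inj₁ (a-only k ex)
          ; _ v≢w (isL l′) ex → contradiction (L.clique l l′ v≢w) ex
          ; _ _ (isM m) ex → inj₂ (b-only m ex) }
        deg v∉ (isM m) with sole-nbr K? (few⇒one-nbr (few-K (proj₁ m))) | sole-nbr L? (few⇒one-nbr (few-L m))
        ... | a , a-only | b , b-only = a , b , λ
          { _ _ (isK k) ex → inj₁ (a-only k ex)
          ; _ _ (isL l) ex → inj₂ (b-only l ex)
          ; _ v≢w (isM m′) ex → contradiction (m-clique m m′ v≢w) ex }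

    module NonadjacentPair {x y} (Mx : M x) (My : M y) (xy : x # y) where

      -- Otherwise take `l′` in `L` away from `m` and `m′`, then `k` in `K` away from all four: the
      -- path `m`, `l`, `l′` with `m′` and `k` is an induced 2P₁+P₃.
      same-nbr : ∀ {m m′ l} → M m → M m′ → L l → m # m′ → m ~ l → m′ ~ l
      same-nbr {m} {m′} {l} Mm Mm′ Ll mm′ ml with rel m′ l
      ... | same refl = contradiction Ll (proj₂ Mm′)
      ... | near e    = e
      ... | far m′l with few-L Mm | few-L Mm′
      ...   | p , fp | q , fq with L.pick (l ∷ p ∷ q ∷ []) (s≤s (s≤s (s≤s z≤n)))
      ...     | l′ , Ll′ , l′∉ with few-K (proj₁ Mm) | few-K (proj₁ Mm′) | few-K (L∌K Ll) | few-K (L∌K Ll′)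
      ...       | p₁ , f₁ | p₂ , f₂ | p₃ , f₃ | p₄ , f₄ with K.pick (p₁ ∷ p₂ ∷ p₃ ∷ p₄ ∷ []) ≤-refl
      ...         | k , Kk , k∉ = ⊥-elim (no-2P₁+P₃ ml (L.clique Ll Ll′ (λ { refl → l′∉ (here refl) }))
        (fp Ll′ (l′∉ ∘ there ∘ here)) (#-sym (f₂ Kk (k∉ ∘ there ∘ here)))
        (#-sym (f₁ Kk (k∉ ∘ here))) (#-sym (f₃ Kk (k∉ ∘ there ∘ there ∘ here)))
        (#-sym (f₄ Kk (k∉ ∘ there ∘ there ∘ there ∘ here)))
        (#-sym mm′) m′l (fq Ll′ (l′∉ ∘ there ∘ there ∘ here)))

      l₀ : V
      l₀ = proj₁ (few-L Mx)

      -- Adjacency to `l` passes between nonadjacent vertices of `M`. If `m` is adjacent to `x`, it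
      -- is not adjacent to `y`, as `M` is a cluster, and the edge passes from `m` to `y` and on to
      -- `x`.
      nbr-l₀ : ∀ {m l} → M m → L l → m ~ l → l ≡ l₀
      nbr-l₀ {m} {l} Mm Ll ml = few-nbr (few-L Mx) Ll x~l
        where
        x~l : x ~ l
        x~l with rel m x | rel m y
        ... | same refl | _         = ml
        ... | far mx    | _         = same-nbr Mm Mx Ll mx ml
        ... | near mx   | same refl = contradiction (~-sym mx) (#⇒≁ xy)
        ... | near mx   | near my   = contradiction xy (m-cluster Mx Mm My (~-sym mx) my)
        ... | near mx   | far my    = same-nbr My Mx Ll (#-sym xy) (same-nbr Mm My Ll my ml)

      -- If `x` has no neighbour in `L`, then `l₀` is arbitrary and may lie in `M`. Excluding it
      -- among vertices of `L` only keeps all of `M` inside `H`.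
      H : V → Set
      H v = ¬ K v × (L v → v ≢ l₀)

      data Side (v : V) : Set where
        inL : L v → v ≢ l₀ → Side v
        inM : M v → Side v

      side : ∀ {v} → H v → Side v
      side {v} (¬k , ≢) with L? v
      ... | yes l = inL l (≢ l)
      ... | no ¬l = inM (¬k , ¬l)

      h-cluster : Cluster H
      h-cluster {a} {b} {c} Ha Hb Hc ab bc ac with side Ha | side Hb | side Hc
      ... | inL la _ | inL _ _  | inL lc _ = #⇒≁ ac (L.clique la lc (proj₁ ac))
      ... | inM ma   | inM mb   | inM mc   = m-cluster ma mb mc ab bc ac
      ... | inL la ≢ | inM mb   | _        = ≢ (nbr-l₀ mb la (~-sym ab))
      ... | inM ma   | inL lb ≢ | _        = ≢ (nbr-l₀ ma lb ab)
      ... | inL _ _  | inL lb ≢ | inM mc   = ≢ (nbr-l₀ mc lb (~-sym bc))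
      ... | inM _    | inM mb   | inL lc ≢ = ≢ (nbr-l₀ mb lc bc)

      -- An edge `u k` extends by some `k′` in `K` away from `u`, `p` and `q` to an induced P₃, and
      -- `p` and `q` complete it to 2P₁+P₃.
      isolated-from-K : ∀ {k u p q} → K k → ¬ K u → ¬ K p → ¬ K q → p # q →
        p # u → q # u → p # k → q # k → ¬ u ~ k
      isolated-from-K {k} Kk ¬Ku ¬Kp ¬Kq pq pu qu pk qk uk
        with few-K ¬Ku | few-K ¬Kp | few-K ¬Kq
      ... | p₁ , f₁ | p₂ , f₂ | p₃ , f₃ with K.pick (k ∷ p₁ ∷ p₂ ∷ p₃ ∷ []) ≤-refl
      ...   | k′ , Kk′ , k′∉ = no-2P₁+P₃ uk (K.clique Kk Kk′ (λ { refl → k′∉ (here refl) }))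
        (f₁ Kk′ (k′∉ ∘ there ∘ here)) pq
        pu pk (f₂ Kk′ (k′∉ ∘ there ∘ there ∘ here))
        qu qk (f₃ Kk′ (k′∉ ∘ there ∘ there ∘ there ∘ here))

      bounded : Bounded
      -- Being in `L` and different from `l₀`, `z` has no neighbour in `M`, so `x`, `y`, `z` are
      -- pairwise nonadjacent. The deleted `p`, `q`, `r` are their possible neighbours in `K`.
      bounded with L.pick (l₀ ∷ []) (s≤s z≤n)
      ... | z , Lz , z∉ with few-K (proj₁ Mx) | few-K (proj₁ My) | few-K (L∌K Lz)
      ...   | p , fp | q , fq | r , fr = cluster⇒bounded S (m≤m+n 4 (ramseyBound 5 5)) cluster
        where
        S : List V
        S = l₀ ∷ p ∷ q ∷ r ∷ []

        z≢l₀ : z ≢ l₀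
        z≢l₀ = z∉ ∘ here

        far-z : ∀ {m} → M m → m # z
        far-z Mm = ≁⇒# (λ { refl → proj₂ Mm Lz }) (z≢l₀ ∘ nbr-l₀ Mm Lz)

        m⊆h : ∀ {m} → M m → H m
        m⊆h (¬k , ¬l) = ¬k , λ l → contradiction l ¬l

        Hz : H z
        Hz = L∌K Lz , λ _ → z≢l₀

        data Part (v : V) : Set where
          inK : K v → Part v
          inH : H v → Part v

        part : ∀ {v} → v ∉ S → Part v
        part {v} v∉ with K? v
        ... | yes k = inK k
        ... | no ¬k = inH (¬k , λ _ → v∉ ∘ here)

        -- As `H` is a cluster, `u` is adjacent to at most one of `x`, `y`, `z`. Unless `u` is
        -- itself one of them, two remain that are nonadjacent to both `u` and `k`, and
        -- `isolated-from-K` applies.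
        apart : ∀ {k u} → k ∉ S → K k → H u → ¬ u ~ k
        apart {k} {u} k∉ Kk Hu uk = cases
          (fp Kk (k∉ ∘ there ∘ here)) (fq Kk (k∉ ∘ there ∘ there ∘ here))
          (fr Kk (k∉ ∘ there ∘ there ∘ there ∘ here))
          where
          cases : x # k → y # k → z # k → ⊥
          cases xk yk zk with rel u x | rel u y | rel u z
          ... | same refl | _ | _ = #⇒≁ xk uk
          ... | _ | same refl | _ = #⇒≁ yk uk
          ... | _ | _ | same refl = #⇒≁ zk uk
          ... | near ux | near uy | _ = h-cluster (m⊆h Mx) Hu (m⊆h My) (~-sym ux) uy xy
          ... | near ux | _ | near uz = h-cluster (m⊆h Mx) Hu Hz (~-sym ux) uz (far-z Mx)
          ... | _ | near uy | near uz = h-cluster (m⊆h My) Hu Hz (~-sym uy) uz (far-z My)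
          ... | far ux | far uy | _ = isolated-from-K Kk (proj₁ Hu) (proj₁ Mx) (proj₁ My)
            xy (#-sym ux) (#-sym uy) xk yk uk
          ... | far ux | _ | far uz = isolated-from-K Kk (proj₁ Hu) (proj₁ Mx) (L∌K Lz)
            (far-z Mx) (#-sym ux) (#-sym uz) xk zk uk
          ... | _ | far uy | far uz = isolated-from-K Kk (proj₁ Hu) (proj₁ My) (L∌K Lz)
            (far-z My) (#-sym uy) (#-sym uz) yk zk uk

        cluster : Cluster (_∉ S)
        cluster a∉ b∉ c∉ ab bc ac with part a∉ | part b∉ | part c∉
        ... | inK ka | inK _  | inK kc = #⇒≁ ac (K.clique ka kc (proj₁ ac))
        ... | inH ha | inH hb | inH hc = h-cluster ha hb hc ab bc ac
        ... | inK ka | inH hb | _      = apart a∉ ka hb (~-sym ab)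
        ... | inH ha | inK kb | _      = apart b∉ kb ha ab
        ... | inK _  | inK kb | inH hc = apart b∉ kb hc (~-sym bc)
        ... | inH _  | inH hb | inK kc = apart c∉ kc hb bc

  -- Case distinction by Ramsey's theorem

  bounded : Bounded
  bounded with ramseyBound 5 5 ≤? n G
  ... | no small = cluster⇒bounded (allFin (n G))
    (≤-trans (≤-reflexive (length-tabulate id)) (≤-trans (<⇒≤ (≰⇒> small)) (m≤n+m _ 4)))
    (λ x∉ → contradiction (∈-allFin _) x∉)
  ... | yes large with ramsey 5 5 (allFin⁺ (n G)) (≤-trans large (≤-reflexive (sym (length-tabulate id))))
  ...   | inj₂ indep = independent⇒bounded indep
  ...   | inj₁ core with maximalClique (λ _ → yes tt) (λ _ → tt) core
  ...     | MK = outside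
    where
    open MaximalClique MK using (K; K?; clique)

    rest : List V
    rest = filter (¬? ∘ K?) (allFin (n G))

    outside : Bounded
    outside with ramseyBound 5 5 ≤? length rest
    ... | no few-rest = cluster⇒bounded rest (≤-trans (<⇒≤ (≰⇒> few-rest)) (m≤n+m _ 4))
        λ x∉ _ z∉ _ _ xz → #⇒≁ xz (clique (in-K x∉) (in-K z∉) (proj₁ xz))
      where
      in-K : ∀ {v} → v ∉ rest → K v
      in-K {v} v∉ with K? v
      ... | yes k = k
      ... | no ¬k = contradiction (∈-filter⁺ (¬? ∘ K?) (∈-allFin v) ¬k) v∉
    ... | yes many with ramsey 5 5 (filter⁺ (¬? ∘ K?) (allFin⁺ (n G))) many
    ...   | inj₂ indep = independent⇒bounded indep
    ...   | inj₁ core′ with maximalClique (¬? ∘ K?)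
                              (λ v∈ → proj₂ (∈-filter⁻ (¬? ∘ K?) {xs = allFin (n G)} v∈)) core′
    ...     | ML = third
      where
      open TwoCliques MK ML

      third : Bounded
      third with any? (λ x → any? (λ y → M? x ×-dec M? y ×-dec (x #? y)))
      ... | yes (x , y , Mx , My , xy) = NonadjacentPair.bounded Mx My xy
      ... | no ¬∃ = ThreeCliques.bounded λ Mu Mv u≢v → m-adj Mu Mv u≢v
        where
        m-adj : IsClique M
        m-adj {u} {v} Mu Mv u≢v with rel u v
        ... | same eq = contradiction eq u≢v
        ... | near uv = uv
        ... | far uv  = contradiction (u , v , Mu , Mv , uv) ¬∃

theorem1 : BoundedCW (λ G → Free diamond G × Free 2P₁+P₃ G)
theorem1 = 2 * (4 + ramseyBound 5 5 + 12) , λ G (diamond-free , 2P₁+P₃-free) →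
  Structure.bounded G diamond-free 2P₁+P₃-free
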